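{- For every integer $m\ge 3$, the arc set of the directed graph $D_3(m)$ can be partitioned into three arc-disjoint directed Hamilton cycles.
   Context: Fix an integer $m\ge 3$ and write $\mathbb Z_m=\mathbb Z/m\mathbb Z$. Let $V=(\mathbb Z_m)^3$ and let $e_1=(1,0,0)$, $e_2=(0,1,0)$, $e_3=(0,0,1)$. The directed graph $D_3(m)$ (the Cayley digraph $\mathrm{Cay}((\mathbb Z_m)^3,\{e_1,e_2,e_3\})$, equivalently the Cartesian product of three directed $m$-cycles) has vertex set $V$ and the $3m^3$ arcs $v\to v+e_1$, $v\to v+e_2$, $v\to v+e_3$ for $v\in V$ (arithmetic mod $m$). A directed Hamilton cycle is a directed cycle through all $m^3$ vertices. -}

module Defs where

open import Data.Nat using (ℕ; zero; suc; _*_; _≥_)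
open import Data.Nat.DivMod using (_mod_)
open import Data.Fin using (Fin; zero; suc; toℕ)
open import Data.Product using (Σ; _×_; _,_)
open import Relation.Binary.PropositionalEquality using (_≡_)
open import Function.Definitions using (Injective)

inc : ∀ {n} → Fin n → Fin n
inc {suc n} i = suc (toℕ i) mod suc n

V : ℕ → Set
V m = Fin m × Fin m × Fin m

_+e_ : ∀ {m} → V m → Fin 3 → V m
(a , b , c) +e zero = (inc a , b , c)
(a , b , c) +e suc zero = (a , inc b , c)
(a , b , c) +e suc (suc zero) = (a , b , inc c)

-- Arcs of D₃(m): an arc v → v + e_i is recorded as the pair (v , i).
-- (For m ≥ 3, and indeed m ≥ 2, distinct pairs give distinct arcs, so this
-- is exactly the set of 3m³ arcs.)
Arc : ℕ → Set
Arc m = V m × Fin 3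

tail head : ∀ {m} → Arc m → V m
tail (v , i) = v
head (v , i) = v +e i

-- A directed Hamilton cycle in D₃(m): a cyclic sequence of m³ pairwise
-- distinct vertices (hence all vertices), w₀ → w₁ → … → w_{m³-1} → w₀,
-- together with the arc used at each step.
record HamiltonCycle (m : ℕ) : Set where
  field
    vertex    : Fin (m * m * m) → V m
    injective : Injective _≡_ _≡_ vertex
    arc       : Fin (m * m * m) → Arc m
    arc-tail  : ∀ k → tail (arc k) ≡ vertex k
    arc-head  : ∀ k → head (arc k) ≡ vertex (inc k)

_∈Arcs_ : ∀ {m} → Arc m → HamiltonCycle m → Set
a ∈Arcs C = Σ (Fin _) λ k → HamiltonCycle.arc C k ≡ a

ArcPartition : ∀ {m} → (Fin 3 → HamiltonCycle m) → Set
ArcPartition {m} C =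
  (a : Arc m) → Σ (Fin 3) λ j → (a ∈Arcs C j) × (∀ j′ → a ∈Arcs C j′ → j′ ≡ j)

{-# OPTIONS --safe #-}
-- Every arc increases x + y + z by one, so V splits into m layers and each layer may choose
-- independently which colour leaves a vertex in which direction. A colour class is a Hamilton
-- cycle as soon as its step map has a single orbit, and this is read off the return map to a
-- single layer, a map of (Z_m)². In most layers the choice is constant, so the return maps are
-- close to translations.
-- For odd m, two layers, in which two colours are exchanged on a line, turn the three return
-- maps into odometers; 2 being invertible modulo m is what makes one of them traverse its rows.
-- For even m a parity obstruction (the product of the signs of the three return maps) forces a
-- layer in which all three colours interact. It is chosen invariant under the rotation
-- (x , y , z) ↦ (z , x , y) combined with a cyclic shift of directions and colours, so that
-- only one return map has to be analysed; that map traverses (Z_m)² row by row.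
module Submission where

open import Defs
open import Data.Nat using (ℕ; zero; suc; _+_; _*_; _≤_; _<_; _≥_; _%_; _/_; z≤n; s≤s; z<s; s<s; NonZero)
open import Data.Nat.Properties renaming (_≟_ to _≟ℕ_)
open import Data.Nat.DivMod
open import Data.Nat.GeneralisedArithmetic using (fold; fold-+)
open import Data.Nat.Tactic.RingSolver using (solve-∀)
open import Data.Fin using (Fin; zero; suc; toℕ; fromℕ<; combine; remQuot; punchOut; opposite)
open import Data.Fin.Patterns using (0F; 1F; 2F)
open import Data.Fin.Properties
  using (toℕ<n; toℕ-injective; toℕ-fromℕ<; combine-injective; combine-remQuot;
         cantor-schröder-bernstein; any?; all?; punchOut-injective; <⇒notInjective)
  renaming (_≟_ to _≟ᶠ_)
open import Data.Product using (Σ; _×_; _,_; proj₁; proj₂; uncurry)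
open import Data.Product.Properties using (≡-dec)
open import Data.Sum using (_⊎_; inj₁; inj₂)
open import Data.Unit using (tt)
open import Data.Vec using (Vec; []; _∷_; lookup)
open import Function using (_∘_)
open import Function.Definitions using (Injective)
open import Relation.Binary using (DecidableEquality; tri<; tri≈; tri>)
open import Relation.Binary.PropositionalEquality
open import Relation.Nullary using (¬_; Dec; yes; no; contradiction; _×-dec_; _⊎-dec_; ¬?)
open import Relation.Nullary.Decidable using (toWitness; map′)

-- Finite orbits and Hamilton cycles

infix 4 _⊢_⟶_ _⊢_⟶⁺_

_⊢_⟶_ : ∀ {A : Set} → (A → A) → A → A → Set
f ⊢ u ⟶ v = Σ ℕ λ n → fold u f n ≡ v

_⊢_⟶⁺_ : ∀ {A : Set} → (A → A) → A → A → Set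
f ⊢ u ⟶⁺ v = Σ ℕ λ n → fold u f (suc n) ≡ v

⟶-refl : ∀ {A : Set} {f : A → A} {u} → f ⊢ u ⟶ u
⟶-refl = 0 , refl

⟶-step : ∀ {A : Set} {f : A → A} {u v w} → f ⊢ u ⟶ v → f v ≡ w → f ⊢ u ⟶⁺ w
⟶-step {f = f} (n , p) q = n , trans (cong f p) q

⟶⁺⇒⟶ : ∀ {A : Set} {f : A → A} {u v} → f ⊢ u ⟶⁺ v → f ⊢ u ⟶ v
⟶⁺⇒⟶ (n , p) = suc n , p

⟶-trans : ∀ {A : Set} {f : A → A} {u v w} → f ⊢ u ⟶ v → f ⊢ v ⟶ w → f ⊢ u ⟶ w
⟶-trans {f = f} {u} (n , p) (k , q) =
  k + n , trans (fold-+ u f k) (trans (cong (λ v → fold v f k) p) q)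

⟶-⟶⁺-trans : ∀ {A : Set} {f : A → A} {u v w} → f ⊢ u ⟶ v → f ⊢ v ⟶⁺ w → f ⊢ u ⟶⁺ w
⟶-⟶⁺-trans r (k , q) = ⟶-step (⟶-trans r (k , refl)) q

-- The return to `o` takes at least one step, so that a period can be extracted from it.
SingleOrbit : ∀ {A : Set} → (A → A) → Set
SingleOrbit {A} f = Σ A λ o → (f ⊢ o ⟶⁺ o) × (∀ v → f ⊢ o ⟶ v)

least : ∀ {P : ℕ → Set} → (∀ n → Dec (P n)) → ∀ n → P n →
  Σ ℕ λ k → P k × (∀ {j} → j < k → ¬ P j)
least P? n       p with P? 0
least P? n       p | yes p₀ = 0 , p₀ , λ ()
least P? zero    p | no ¬p₀ = contradiction p ¬p₀
least P? (suc n) p | no ¬p₀ with least (P? ∘ suc) n p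
... | k , pₖ , min = suc k , pₖ , λ { {zero} _ → ¬p₀ ; {suc j} (s≤s j<k) → min j<k }

module Period {A : Set} (f : A → A) (o : A) (p : ℕ) .{{_ : NonZero p}}
  (period : fold o f p ≡ o) where

  fold-* : ∀ k → fold o f (k * p) ≡ o
  fold-* zero    = refl
  fold-* (suc k) = trans (fold-+ o f p) (trans (cong (λ v → fold v f p) (fold-* k)) period)

  fold-% : ∀ n → fold o f (n % p) ≡ fold o f n
  fold-% n = sym (begin
    fold o f n                            ≡⟨ cong (fold o f) (m≡m%n+[m/n]*n n p) ⟩
    fold o f (n % p + n / p * p)          ≡⟨ fold-+ o f (n % p) ⟩
    fold (fold o f (n / p * p)) f (n % p) ≡⟨ cong (λ v → fold v f (n % p)) (fold-* (n / p)) ⟩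
    fold o f (n % p)                      ∎)
    where open ≡-Reasoning

module _ {A : Set} {N : ℕ} (enc : A → Fin N) (dec : Fin N → A)
  (enc-injective : Injective _≡_ _≡_ enc) (dec-injective : Injective _≡_ _≡_ dec)
  (f : A → A) where

  private
    _≟_ : DecidableEquality A
    u ≟ v with enc u ≟ᶠ enc v
    ... | yes eq = yes (enc-injective eq)
    ... | no neq = no (neq ∘ cong enc)

  -- The least period p of o is N: the orbit of o has exactly p elements, and it is all of A.
  singleOrbit⇒period : (orb : SingleOrbit f) → let o = proj₁ orb in
    (fold o f N ≡ o) ×
    (∀ {i j} → i < N → j < N → fold o f i ≡ fold o f j → i ≡ j) ×
    (∀ v → Σ (Fin N) λ k → fold o f (toℕ k) ≡ v)
  singleOrbit⇒period (o , (n₀ , closed) , reach)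
    with least (λ n → fold o f (suc n) ≟ o) n₀ closed
  ... | p₋₁ , period , minimal = conclude (cantor-schröder-bernstein g-injective h-injective)
    where
    p : ℕ
    p = suc p₋₁

    open Period f o p period

    -- If the points at times `i` and `j` agreed, the `p - j` steps that lead from time `j` back to
    -- `o` would do so from time `i` as well, a return after `i + (p - j) < p` steps.
    distinct : ∀ {i j} → i < j → j < p → fold o f i ≢ fold o f j
    distinct {i} {j} i<j j<p eq with m≤n⇒∃[o]m+o≡n j<p
    ... | d , refl = minimal {d + i} (<-≤-trans (+-monoʳ-< d i<j) (≤-reflexive (+-comm d j))) (begin
      fold o f (suc d + i)          ≡⟨ fold-+ o f (suc d) ⟩
      fold (fold o f i) f (suc d)   ≡⟨ cong (λ v → fold v f (suc d)) eq ⟩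
      fold (fold o f j) f (suc d)   ≡⟨ fold-+ o f (suc d) ⟨
      fold o f (suc d + j)          ≡⟨ cong (fold o f ∘ suc) (+-comm d j) ⟩
      fold o f p                    ≡⟨ period ⟩
      o                             ∎)
      where open ≡-Reasoning

    fold-injective : ∀ {i j} → i < p → j < p → fold o f i ≡ fold o f j → i ≡ j
    fold-injective {i} {j} i<p j<p eq with <-cmp i j
    ... | tri< i<j _ _ = contradiction eq (distinct i<j j<p)
    ... | tri≈ _ i≡j _ = i≡j
    ... | tri> _ _ j<i = contradiction (sym eq) (distinct j<i i<p)

    index : ∀ v → Σ (Fin p) λ k → fold o f (toℕ k) ≡ v
    index v with reach v
    ... | n , eq = n mod p ,
      trans (cong (fold o f) (toℕ-fromℕ< (m%n<n n p))) (trans (fold-% n) eq)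

    g : Fin p → Fin N
    g k = enc (fold o f (toℕ k))

    g-injective : Injective _≡_ _≡_ g
    g-injective {i} {j} eq = toℕ-injective (fold-injective (toℕ<n i) (toℕ<n j) (enc-injective eq))

    -- The injection opposite to `g`: every element of `A` has an orbit time below `p`. The two
    -- together force `p ≡ N`.
    h : Fin N → Fin p
    h k = proj₁ (index (dec k))

    h-injective : Injective _≡_ _≡_ h
    h-injective {i} {j} eq = dec-injective (begin
      dec i               ≡⟨ proj₂ (index (dec i)) ⟨
      fold o f (toℕ (h i)) ≡⟨ cong (fold o f ∘ toℕ) eq ⟩
      fold o f (toℕ (h j)) ≡⟨ proj₂ (index (dec j)) ⟩
      dec j               ∎)
      where open ≡-Reasoning

    conclude : ∀ {N} → p ≡ N →
      (fold o f N ≡ o) ×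
      (∀ {i j} → i < N → j < N → fold o f i ≡ fold o f j → i ≡ j) ×
      (∀ v → Σ (Fin N) λ k → fold o f (toℕ k) ≡ v)
    conclude refl = period , fold-injective , index

-- From single orbits to Hamilton cycles and arc partitions

encode : ∀ {m} → V m → Fin (m * m * m)
encode (a , b , c) = combine (combine a b) c

encode-injective : ∀ {m} → Injective _≡_ _≡_ (encode {m})
encode-injective {m} {a , b , c} {a′ , b′ , c′} eq
  with combine-injective (combine a b) c (combine a′ b′) c′ eq
... | eq₁ , refl with combine-injective a b a′ b′ eq₁
... | refl , refl = refl

decode : ∀ {m} → Fin (m * m * m) → V m
decode {m} k = let ab , c = remQuot {m * m} m k ; a , b = remQuot {m} m ab in a , b , c

encode-decode : ∀ {m} (k : Fin (m * m * m)) → encode {m} (decode k) ≡ k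
encode-decode {m} k = begin
  combine (uncurry combine (remQuot {m} m ab)) c ≡⟨ cong (λ i → combine i c) (combine-remQuot {m} m ab) ⟩
  combine ab c                                   ≡⟨ combine-remQuot {m * m} m k ⟩
  k                                              ∎
  where
  open ≡-Reasoning
  ab : Fin (m * m)
  ab = proj₁ (remQuot {m * m} m k)
  c : Fin m
  c = proj₂ (remQuot {m * m} m k)

decode-injective : ∀ {m} → Injective _≡_ _≡_ (decode {m})
decode-injective {m} {i} {j} eq =
  trans (sym (encode-decode {m} i)) (trans (cong encode eq) (encode-decode {m} j))

toℕ-inc : ∀ {n} (i : Fin n) →
  (toℕ (inc i) ≡ suc (toℕ i)) ⊎ (suc (toℕ i) ≡ n × toℕ (inc i) ≡ 0)
toℕ-inc {suc n} i with m≤n⇒m<n∨m≡n (toℕ<n i)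
... | inj₁ lt = inj₁ (trans (toℕ-fromℕ< _) (m<n⇒m%n≡m lt))
... | inj₂ eq = inj₂ (eq , trans (toℕ-fromℕ< _) (trans (cong (_% suc n) eq) (n%n≡0 (suc n))))

step : ∀ {m} → (V m → Fin 3) → V m → V m
step d v = v +e d v

module _ {m : ℕ} (d : V m → Fin 3) (orb : SingleOrbit (step d)) where

  private
    o : V m
    o = proj₁ orb
    facts = singleOrbit⇒period encode decode encode-injective decode-injective (step d) orb

  hamiltonCycle : HamiltonCycle m
  hamiltonCycle = record
    { vertex    = vertex
    ; injective = λ {i} {j} eq → toℕ-injective (proj₁ (proj₂ facts) (toℕ<n i) (toℕ<n j) eq)
    ; arc       = λ k → vertex k , d (vertex k)
    ; arc-tail  = λ _ → refl
    ; arc-head  = arc-head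
    }
    where
    vertex : Fin (m * m * m) → V m
    vertex k = fold o (step d) (toℕ k)
    arc-head : ∀ k → step d (vertex k) ≡ vertex (inc k)
    arc-head k with toℕ-inc k
    ... | inj₁ eq = cong (fold o (step d)) (sym eq)
    -- The last arc closes the cycle because the period is exactly `m * m * m`.
    ... | inj₂ (last , first) =
      trans (cong (fold o (step d)) last) (trans (proj₁ facts) (cong (fold o (step d)) (sym first)))

  ∈hamiltonCycle : ∀ v → (v , d v) ∈Arcs hamiltonCycle
  ∈hamiltonCycle v with proj₂ (proj₂ facts) v
  ... | k , eq = k , cong (λ u → u , d u) eq

  ∈hamiltonCycle⁻ : ∀ {v i} → (v , i) ∈Arcs hamiltonCycle → d v ≡ i
  ∈hamiltonCycle⁻ (k , refl) = refl

-- Pigeonhole: if `i` were missed, punching it out of the codomain would inject `Fin (suc n)` into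
-- `Fin n`.
injective⇒surjective : ∀ {n} (f : Fin n → Fin n) → Injective _≡_ _≡_ f → ∀ i → Σ (Fin n) λ j → f j ≡ i
injective⇒surjective {suc n} f inj i with any? (λ j → f j ≟ᶠ i)
... | yes found = found
... | no ¬found = contradiction
  (λ {j k} eq → inj {j} {k} (punchOut-injective (i≢f j) (i≢f k) eq))
  (<⇒notInjective {f = λ j → punchOut (i≢f j)} (n<1+n n))
  where
  i≢f : ∀ j → i ≢ f j
  i≢f j eq = ¬found (j , sym eq)

Decomposition : ℕ → Set
Decomposition m = Σ (Fin 3 → HamiltonCycle m) λ C → ArcPartition C

-- At each vertex three different directions are all the directions, so the arc `(v , i)` lies on
-- the cycle of exactly one colour, the `c` with `dir c v ≡ i`.
decomposition : ∀ {m} (dir : Fin 3 → V m → Fin 3) →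
  (∀ v → Injective _≡_ _≡_ (λ c → dir c v)) →
  (∀ c → SingleOrbit (step (dir c))) → Decomposition m
decomposition {m} dir dir-injective orb = C , partition
  where
  C : Fin 3 → HamiltonCycle m
  C c = hamiltonCycle (dir c) (orb c)
  partition : ArcPartition C
  partition (v , i) with injective⇒surjective (λ c → dir c v) (dir-injective v) i
  ... | c , refl = c , ∈hamiltonCycle (dir c) (orb c) v ,
    λ c′ a∈C → dir-injective v (∈hamiltonCycle⁻ (dir c′) (orb c′) a∈C)

-- Rotation-invariant decompositions

rotate unrotate : ∀ {m} → V m → V m
rotate   (x , y , z) = z , x , y
unrotate (x , y , z) = y , z , x

singleOrbit-conjugate : ∀ {A B : Set} {f : A → A} {g : B → B} (φ : A → B) (ψ : B → A) →
  (∀ b → φ (ψ b) ≡ b) → (∀ a → φ (f a) ≡ g (φ a)) → SingleOrbit f → SingleOrbit g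
singleOrbit-conjugate {f = f} {g} φ ψ φψ φf (o , (n , closed) , reach) =
  φ o , (n , trans (sym (φ-fold (suc n))) (cong φ closed)) ,
  λ b → let k , eq = reach (ψ b) in k , trans (sym (φ-fold k)) (trans (cong φ eq) (φψ b))
  where
  φ-fold : ∀ k → φ (fold o f k) ≡ fold (φ o) g k
  φ-fold zero    = refl
  φ-fold (suc k) = trans (φf (fold o f k)) (cong g (φ-fold k))

rotate-+e : ∀ {m} (v : V m) i → rotate (v +e i) ≡ rotate v +e inc i
rotate-+e v 0F = refl
rotate-+e v 1F = refl
rotate-+e v 2F = refl

-- The image of a colour class under the digraph automorphism `rotate`, which by `rotate-+e` shifts
-- directions by `inc`.
rotated : ∀ {m} → (V m → Fin 3) → V m → Fin 3
rotated d v = inc (d (unrotate v))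

rotated-singleOrbit : ∀ {m} (d : V m → Fin 3) → SingleOrbit (step d) → SingleOrbit (step (rotated d))
rotated-singleOrbit d = singleOrbit-conjugate rotate unrotate (λ _ → refl) (λ v → rotate-+e v (d v))

rotations : ∀ {m} → (V m → Fin 3) → Fin 3 → V m → Fin 3
rotations d 0F = d
rotations d 1F = rotated d
rotations d 2F = rotated (rotated d)

AllDistinct : Fin 3 → Fin 3 → Fin 3 → Set
AllDistinct i j k = i ≢ j × i ≢ k × j ≢ k

allDistinct? : ∀ i j k → Dec (AllDistinct i j k)
allDistinct? i j k = ¬? (i ≟ᶠ j) ×-dec ¬? (i ≟ᶠ k) ×-dec ¬? (j ≟ᶠ k)

allDistinct⇒injective : ∀ (f : Fin 3 → Fin 3) → AllDistinct (f 0F) (f 1F) (f 2F) → Injective _≡_ _≡_ f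
allDistinct⇒injective f (p , q , r) {0F} {0F} _ = refl
allDistinct⇒injective f (p , q , r) {0F} {1F} e = contradiction e p
allDistinct⇒injective f (p , q , r) {0F} {2F} e = contradiction e q
allDistinct⇒injective f (p , q , r) {1F} {0F} e = contradiction (sym e) p
allDistinct⇒injective f (p , q , r) {1F} {1F} _ = refl
allDistinct⇒injective f (p , q , r) {1F} {2F} e = contradiction e r
allDistinct⇒injective f (p , q , r) {2F} {0F} e = contradiction (sym e) q
allDistinct⇒injective f (p , q , r) {2F} {1F} e = contradiction (sym e) r
allDistinct⇒injective f (p , q , r) {2F} {2F} _ = refl

RotationLatin : ∀ {m} → (V m → Fin 3) → V m → Set
RotationLatin d v = AllDistinct (d v) (rotated d v) (rotated (rotated d) v)

rotation-decomposition : ∀ {m} (d : V m → Fin 3) → (∀ v → RotationLatin d v) →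
  SingleOrbit (step d) → Decomposition m
rotation-decomposition d latin orb =
  decomposition (rotations d) (λ v → allDistinct⇒injective (λ c → rotations d c v) (latin v)) λ
    { 0F → orb
    ; 1F → rotated-singleOrbit d orb
    ; 2F → rotated-singleOrbit (rotated d) (rotated-singleOrbit d orb) }

-- The cases m = 3 and m = 4 by exhaustive evaluation

allV? : ∀ {m} {P : V m → Set} → (∀ v → Dec (P v)) → Dec (∀ v → P v)
allV? P? = map′ (λ h (x , y , z) → h x y z) (λ h x y z → h (x , y , z))
  (all? λ x → all? λ y → all? λ z → P? (x , y , z))

_≟ⱽ_ : ∀ {m} → DecidableEquality (V m)
_≟ⱽ_ = ≡-dec _≟ᶠ_ (≡-dec _≟ᶠ_ _≟ᶠ_)

rotationLatin? : ∀ {m} (d : V m → Fin 3) → Dec (∀ v → RotationLatin d v)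
rotationLatin? d = allV? λ v → allDistinct? (d v) (rotated d v) (rotated (rotated d) v)

reaches? : ∀ {m} (d : V m → Fin 3) (o : V m) (p : ℕ) →
  Dec (∀ v → Σ (Fin p) λ k → fold o (step d) (toℕ k) ≡ v)
reaches? d o p = allV? λ v → any? λ k → fold o (step d) (toℕ k) ≟ⱽ v

bounded⇒singleOrbit : ∀ {A : Set} {f : A → A} {o : A} {p : ℕ} → f ⊢ o ⟶⁺ o →
  (∀ v → Σ (Fin p) λ k → fold o f (toℕ k) ≡ v) → SingleOrbit f
bounded⇒singleOrbit {o = o} closed reach = o , closed , λ v → toℕ (proj₁ (reach v)) , proj₂ (reach v)

-- The general constructions need m ≥ 5; for m = 3 and m = 4 a rotation-invariant solution found
-- by computer search is checked by evaluation.
d₃ : V 3 → Fin 3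
d₃ (x , y , z) = lookup (lookup (lookup table x) y) z
  where
  table : Vec (Vec (Vec (Fin 3) 3) 3) 3
  table =
    ((0F ∷ 0F ∷ 0F ∷ []) ∷ (0F ∷ 2F ∷ 2F ∷ []) ∷ (1F ∷ 1F ∷ 0F ∷ []) ∷ []) ∷
    ((0F ∷ 1F ∷ 1F ∷ []) ∷ (0F ∷ 0F ∷ 0F ∷ []) ∷ (2F ∷ 0F ∷ 2F ∷ []) ∷ []) ∷
    ((2F ∷ 2F ∷ 0F ∷ []) ∷ (1F ∷ 0F ∷ 1F ∷ []) ∷ (0F ∷ 0F ∷ 0F ∷ []) ∷ []) ∷ []

d₃-latin : ∀ v → RotationLatin d₃ v
d₃-latin = toWitness {a? = rotationLatin? d₃} tt

d₃-reaches : ∀ v → Σ (Fin 27) λ k → fold (0F , 0F , 0F) (step d₃) (toℕ k) ≡ v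
d₃-reaches = toWitness {a? = reaches? d₃ (0F , 0F , 0F) 27} tt

decomposition₃ : Decomposition 3
-- `_⊢_⟶⁺_` adds one to its witness: `26` stands for a closed walk of 27 = 3³ steps.
decomposition₃ = rotation-decomposition d₃ d₃-latin (bounded⇒singleOrbit (26 , refl) d₃-reaches)

d₄ : V 4 → Fin 3
d₄ (x , y , z) = layer ((toℕ x + toℕ y + toℕ z) % 4)
  where
  table : Vec (Vec (Fin 3) 4) 4
  table =
    (0F ∷ 2F ∷ 2F ∷ 1F ∷ []) ∷
    (1F ∷ 0F ∷ 0F ∷ 2F ∷ []) ∷
    (1F ∷ 0F ∷ 0F ∷ 0F ∷ []) ∷
    (2F ∷ 1F ∷ 0F ∷ 0F ∷ []) ∷ []
  layer : ℕ → Fin 3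
  layer 0 = lookup (lookup table y) z
  layer 1 = 1F
  layer _ = 2F

d₄-latin : ∀ v → RotationLatin d₄ v
d₄-latin = toWitness {a? = rotationLatin? d₄} tt

d₄-reaches : ∀ v → Σ (Fin 64) λ k → fold (0F , 0F , 0F) (step d₄) (toℕ k) ≡ v
d₄-reaches = toWitness {a? = reaches? d₄ (0F , 0F , 0F) 64} tt

decomposition₄ : Decomposition 4
decomposition₄ = rotation-decomposition d₄ d₄-latin (bounded⇒singleOrbit (63 , refl) d₄-reaches)

-- Layers and paths between them

module Congruence (m₁ : ℕ) where

  m : ℕ
  m = suc m₁

  -- A record, so that Agda can recover a and b from a ≋ b.
  infix 4 _≋_
  record _≋_ (a b : ℕ) : Set where
    constructor mk≋
    field %≡% : a % m ≡ b % m

  ≋-refl : ∀ {a} → a ≋ a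
  ≋-refl = mk≋ refl

  ≋-sym : ∀ {a b} → a ≋ b → b ≋ a
  ≋-sym (mk≋ p) = mk≋ (sym p)

  ≋-trans : ∀ {a b c} → a ≋ b → b ≋ c → a ≋ c
  ≋-trans (mk≋ p) (mk≋ q) = mk≋ (trans p q)

  ≡⇒≋ : ∀ {a b} → a ≡ b → a ≋ b
  ≡⇒≋ refl = ≋-refl

  %-≋ : ∀ a → a % m ≋ a
  %-≋ a = mk≋ (m%n%n≡m%n a m)

  +*-≋ : ∀ a k → a + k * m ≋ a
  +*-≋ a k = mk≋ ([m+kn]%n≡m%n a k m)

  ≡+*⇒≋ : ∀ {a b} k → a ≡ b + k * m → a ≋ b
  ≡+*⇒≋ {b = b} k refl = +*-≋ b k

  +-≋ : ∀ {a a′ b b′} → a ≋ a′ → b ≋ b′ → a + b ≋ a′ + b′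
  +-≋ {a} {a′} {b} {b′} (mk≋ p) (mk≋ q) = mk≋ (begin
    (a + b) % m           ≡⟨ %-distribˡ-+ a b m ⟩
    (a % m + b % m) % m   ≡⟨ cong₂ (λ i j → (i + j) % m) p q ⟩
    (a′ % m + b′ % m) % m ≡⟨ %-distribˡ-+ a′ b′ m ⟨
    (a′ + b′) % m         ∎)
    where open ≡-Reasoning

  -- `m₁` acts as -1 modulo `m`: adding `m₁ * t` to `t + a` leaves `a` plus a multiple of `m`.
  ≋-+-cancelˡ : ∀ t {a b} → t + a ≋ t + b → a ≋ b
  ≋-+-cancelˡ t {a} {b} eq =
    ≋-trans (≋-sym (absorb a)) (≋-trans (+-≋ (≋-refl {m₁ * t}) eq) (absorb b))
    where
    rearrange : ∀ m₁ t a → m₁ * t + (t + a) ≡ a + t * suc m₁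
    rearrange = solve-∀
    absorb : ∀ a → m₁ * t + (t + a) ≋ a
    absorb a = ≡+*⇒≋ t (rearrange m₁ t a)

  m≋0 : m ≋ 0
  m≋0 = ≡+*⇒≋ 1 (sym (*-identityˡ m))

  +m-≋ : ∀ a → a + m ≋ a
  +m-≋ a = ≋-trans (+-≋ (≋-refl {a}) m≋0) (≡⇒≋ (+-identityʳ a))

  ≋⇒% : ∀ {a l} → a ≋ l → l < m → a % m ≡ l
  ≋⇒% (mk≋ p) l<m = trans p (m<n⇒m%n≡m l<m)

  toℕ-mod : ∀ a → toℕ (a mod m) ≡ a % m
  toℕ-mod a = toℕ-fromℕ< (m%n<n a m)

  toℕ-mod-≋ : ∀ a → toℕ (a mod m) ≋ a
  toℕ-mod-≋ a = ≋-trans (≡⇒≋ (toℕ-mod a)) (%-≋ a)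

  mod-cong : ∀ {a b} → a ≋ b → a mod m ≡ b mod m
  mod-cong {a} {b} (mk≋ eq) = toℕ-injective (trans (toℕ-mod a) (trans eq (sym (toℕ-mod b))))

  mod-toℕ : ∀ (i : Fin m) → toℕ i mod m ≡ i
  mod-toℕ i = toℕ-injective (trans (toℕ-mod (toℕ i)) (m<n⇒m%n≡m (toℕ<n i)))

  inc-mod : ∀ a → inc (a mod m) ≡ suc a mod m
  inc-mod a = mod-cong (+-≋ (≋-refl {1}) (toℕ-mod-≋ a))

Triple : Set
Triple = ℕ × ℕ × ℕ

size : Triple → ℕ
size (a , b , c) = a + b + c

add : Fin 3 → ℕ → Triple → Triple
add 0F k (a , b , c) = k + a , b , c
add 1F k (a , b , c) = a , k + b , c
add 2F k (a , b , c) = a , b , k + c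

size-add : ∀ i k p → size (add i k p) ≡ k + size p
size-add 0F k (a , b , c) = lemma k a b c where
  lemma : ∀ k a b c → k + a + b + c ≡ k + (a + b + c)
  lemma = solve-∀
size-add 1F k (a , b , c) = lemma k a b c where
  lemma : ∀ k a b c → a + (k + b) + c ≡ k + (a + b + c)
  lemma = solve-∀
size-add 2F k (a , b , c) = lemma k a b c where
  lemma : ∀ k a b c → a + b + (k + c) ≡ k + (a + b + c)
  lemma = solve-∀

-- Vertices are represented by triples of naturals that need not be reduced modulo m, so that
-- every arc increments a coordinate and no wrap-around occurs along a path.
module Layered (m₁ s : ℕ) where

  open Congruence m₁ public

  pt : Triple → V m
  pt (a , b , c) = a mod m , b mod m , c mod m

  coords : V m → Triple
  coords (x , y , z) = toℕ x , toℕ y , toℕ z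

  pt-coords : ∀ v → pt (coords v) ≡ v
  pt-coords (x , y , z) = cong₂ _,_ (mod-toℕ x) (cong₂ _,_ (mod-toℕ y) (mod-toℕ z))

  pt-cong : ∀ {a a′ b b′ c c′} → a ≋ a′ → b ≋ b′ → c ≋ c′ → pt (a , b , c) ≡ pt (a′ , b′ , c′)
  pt-cong p q r = cong₂ _,_ (mod-cong p) (cong₂ _,_ (mod-cong q) (mod-cong r))

  pt-+e : ∀ p i → pt p +e i ≡ pt (add i 1 p)
  pt-+e (a , b , c) 0F = cong (_, _) (inc-mod a)
  pt-+e (a , b , c) 1F = cong (λ y → _ , y , _) (inc-mod b)
  pt-+e (a , b , c) 2F = cong (λ z → _ , _ , z) (inc-mod c)

  -- The shift `s` selects the residue of x + y + z that becomes layer 0: it is 0 for odd `m`, and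
  -- `m - 6` for even `m`, where layer 0 is x + y + z ≡ 6.
  layer : V m → ℕ
  layer v = s + size (coords v)

  layer-pt : ∀ p → layer (pt p) ≋ s + size p
  layer-pt (a , b , c) = +-≋ (≋-refl {s}) (+-≋ (+-≋ (toℕ-mod-≋ a) (toℕ-mod-≋ b)) (toℕ-mod-≋ c))

  _-e_ : V m → Fin 3 → V m
  v -e i = pt (add i m₁ (coords v))

  -e-+e : ∀ v i → (v -e i) +e i ≡ v
  -e-+e v i = trans (pt-+e (add i m₁ (coords v)) i) (trans (full-turn i (coords v)) (pt-coords v))
    where
    wrap : ∀ a → 1 + (m₁ + a) ≋ a
    wrap a = ≋-trans (≡⇒≋ (+-comm m a)) (+m-≋ a)
    full-turn : ∀ i p → pt (add i 1 (add i m₁ p)) ≡ pt p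
    full-turn 0F (a , b , c) = pt-cong (wrap a) (≋-refl {b}) (≋-refl {c})
    full-turn 1F (a , b , c) = pt-cong (≋-refl {a}) (wrap b) (≋-refl {c})
    full-turn 2F (a , b , c) = pt-cong (≋-refl {a}) (≋-refl {b}) (wrap c)

  layer-+e : ∀ v i → layer (v +e i) ≋ suc (layer v)
  layer-+e v i = ≋-trans (≡⇒≋ (cong layer (trans (cong (_+e i) (sym (pt-coords v))) (pt-+e p i))))
    (≋-trans (layer-pt (add i 1 p))
    (≡⇒≋ (trans (cong (s +_) (size-add i 1 p)) (+-suc s (size p)))))
    where
    p : Triple
    p = coords v

  Onto : (V m → V m) → ℕ → Set
  Onto f k = ∀ v → layer v ≋ suc k → Σ (V m) λ u → layer u ≋ k × f u ≡ v

  layer--e : ∀ {k} v i → layer v ≋ suc k → layer (v -e i) ≋ k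
  layer--e v i eq = ≋-+-cancelˡ 1 (≋-trans (≋-sym (layer-+e (v -e i) i))
    (≋-trans (≡⇒≋ (cong layer (-e-+e v i))) eq))

  step--e : ∀ (d : V m → Fin 3) v {i} → d (v -e i) ≡ i → step d (v -e i) ≡ v
  step--e d v {i} eq = trans (cong ((v -e i) +e_) eq) (-e-+e v i)

  const-onto : ∀ (d : V m → Fin 3) k i → (∀ u → layer u ≋ k → d u ≡ i) → Onto (step d) k
  const-onto d k i const v eq = v -e i , layer--e v i eq , step--e d v (const (v -e i) (layer--e v i eq))

  AllAt : (V m → V m) → V m → ℕ → Set
  AllAt f o k = ∀ v → layer v ≋ k → f ⊢ o ⟶ v

  allAt-suc : ∀ {f o k} → Onto f k → AllAt f o k → AllAt f o (suc k)
  allAt-suc onto all v eq with onto v eq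
  ... | u , at-k , refl = ⟶⁺⇒⟶ (⟶-step (all u at-k) refl)

  -- Each onto step passes reachability of a whole layer on to the next one, and `m₁ = m - 1` such
  -- steps meet all the other layers.
  cover : ∀ {f o} k₀ → AllAt f o k₀ → (∀ k → k₀ ≤ k → k < k₀ + m₁ → Onto f k) → ∀ v → f ⊢ o ⟶ v
  cover {f} {o} k₀ all onto v = climb j (≤-pred (m%n<n (layer v + m₁ * k₀) m)) v at
    where
    climb : ∀ j → j ≤ m₁ → AllAt f o (j + k₀)
    climb zero    _ = all
    climb (suc j) j<m₁ = allAt-suc
      (onto (j + k₀) (m≤n+m k₀ j) (≤-trans (+-monoˡ-≤ k₀ j<m₁) (≤-reflexive (+-comm m₁ k₀))))
      (climb j (<⇒≤ j<m₁))
    -- The distance from layer `k₀` to the layer of `v`, with `m₁ * k₀` in place of `- k₀`.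
    j : ℕ
    j = (layer v + m₁ * k₀) % m
    rearrange : ∀ l m₁ k → l + m₁ * k + k ≡ l + k * suc m₁
    rearrange = solve-∀
    at : layer v ≋ j + k₀
    at = ≋-sym (≋-trans (+-≋ (%-≋ (layer v + m₁ * k₀)) ≋-refl) (≡+*⇒≋ k₀ (rearrange (layer v) m₁ k₀)))

  module Rule (δ : ℕ → Triple → Fin 3) where

    d : V m → Fin 3
    d v = δ (layer v % m) (coords v)

    reduced : Triple → Triple
    reduced (a , b , c) = a % m , b % m , c % m

    d-pt : ∀ {l} p → s + size p ≋ l → l < m → d (pt p) ≡ δ l (reduced p)
    d-pt {l} p eq l<m = cong₂ δ (≋⇒% (≋-trans (layer-pt p) eq) l<m) (coords-pt p)
      where
      coords-pt : ∀ p → coords (pt p) ≡ reduced p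
      coords-pt (a , b , c) = cong₂ _,_ (toℕ-mod a) (cong₂ _,_ (toℕ-mod b) (toℕ-mod c))

    step-pt : ∀ {l i} p → s + size p ≋ l → l < m → δ l (reduced p) ≡ i →
      step d (pt p) ≡ pt (add i 1 p)
    step-pt p eq l<m refl = trans (cong (pt p +e_) (d-pt p eq l<m)) (pt-+e p _)

    -- By `j + l ≤ m` the layers left, `l` to `l + j - 1`, are all below `m`, so `δ` is read at
    -- these very numbers; arrival in layer `m`, that is layer 0, is allowed.
    run : ∀ i j {l} p → (∀ t q → t < j → δ (t + l) q ≡ i) → s + size p ≋ l → j + l ≤ m →
      step d ⊢ pt p ⟶ pt (add i j p)
    run i zero    p const eq j+l≤m = 0 , cong pt (sym (add-0 i p))
      where
      add-0 : ∀ i p → add i 0 p ≡ p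
      add-0 0F p = refl
      add-0 1F p = refl
      add-0 2F p = refl
    run i (suc j) {l} p const eq j+l<m = ⟶⁺⇒⟶ (⟶-step
      (run i j p (λ t q t<j → const t q (m<n⇒m<1+n t<j)) eq (<⇒≤ j+l<m))
      (trans (step-pt (add i j p) at j+l<m (const j _ ≤-refl)) (cong pt (add-suc i p))))
      where
      add-suc : ∀ i p → add i 1 (add i j p) ≡ add i (suc j) p
      add-suc 0F p = refl
      add-suc 1F p = refl
      add-suc 2F p = refl
      rearrange : ∀ s j t → s + (j + t) ≡ j + (s + t)
      rearrange = solve-∀
      at : s + size (add i j p) ≋ j + l
      at = ≋-trans (≡⇒≋ (trans (cong (s +_) (size-add i j p)) (rearrange s j (size p))))
        (+-≋ (≋-refl {j}) eq)

    const-layer-onto : ∀ {k l} i → k ≋ l → l < m → (∀ q → δ l q ≡ i) → Onto (step d) k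
    const-layer-onto {k} i k≋l l<m const = const-onto d k i λ u eq →
      trans (cong (λ t → δ t (coords u)) (≋⇒% (≋-trans eq k≋l) l<m)) (const _)

parity : ∀ n → Σ ℕ λ h → n ≡ h * 2 ⊎ n ≡ suc (h * 2)
parity zero = 0 , inj₁ refl
parity (suc n) with parity n
... | h , inj₁ refl = h , inj₂ refl
... | h , inj₂ refl = suc h , inj₁ refl

-- Odd m

-- Counting with a fast digit `u` and a slow digit `w`. The slow digit has no upper bound, which
-- suits coordinates that are not reduced modulo `m`.
odometer : ∀ (Q : ℕ → ℕ → Set) k → (∀ u w → u < k → Q u w → Q (suc u) w) →
  (∀ w → Q k w → Q 0 (suc w)) → Q 0 0 → ∀ u w → u ≤ k → Q u w
odometer Q k inner carry start = digit
  where
  digit : ∀ u w → u ≤ k → Q u w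
  digit zero    zero    _   = start
  digit zero    (suc w) _   = carry w (digit k w ≤-refl)
  digit (suc u) w       u<k = inner u w u<k (digit u w (<⇒≤ u<k))

-- The direction of colour c, given the layer and the coordinates of a vertex.
rule : Fin 3 → ℕ → Triple → Fin 3
rule c 0 (zero  , _ , _) = inc c
rule c 0 (suc _ , _ , _) = opposite c
rule c 1 (_ , zero  , _) = c
rule c 1 (_ , suc _ , _) = opposite c
rule c 2 _ = c
rule c 3 _ = inc (inc c)
rule c _ _ = opposite c

-- Every clause is a permutation of the colours. In layer 0, `inc` and `opposite` differ by
-- exchanging colours 0 and 1; in layer 1, the identity and `opposite` differ by exchanging colours
-- 0 and 2.
rule-injective : ∀ l p → Injective _≡_ _≡_ (λ c → rule c l p)
rule-injective l p = allDistinct⇒injective (λ c → rule c l p) (distinct l p)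
  where
  distinct : ∀ l p → AllDistinct (rule 0F l p) (rule 1F l p) (rule 2F l p)
  distinct 0 (zero  , _ , _) = (λ ()) , (λ ()) , (λ ())
  distinct 0 (suc _ , _ , _) = (λ ()) , (λ ()) , (λ ())
  distinct 1 (_ , zero  , _) = (λ ()) , (λ ()) , (λ ())
  distinct 1 (_ , suc _ , _) = (λ ()) , (λ ()) , (λ ())
  distinct 2 _ = (λ ()) , (λ ()) , (λ ())
  distinct 3 _ = (λ ()) , (λ ()) , (λ ())
  distinct (suc (suc (suc (suc _)))) _ = (λ ()) , (λ ()) , (λ ())

module Odd (n : ℕ) where

  open Layered (4 + n) 0

  0<m : 0 < m
  0<m = z<s
  1<m : 1 < m
  1<m = s<s z<s
  2<m : 2 < m
  2<m = s<s (s<s z<s)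
  3<m : 3 < m
  3<m = s<s (s<s (s<s z<s))

  -- The return map of colour 1

  module Colour₁ where

    open Rule (rule 1F)

    f : V m → V m
    f = step d

    -- Layer 1, parametrised by x and z: `4 + n` is -1 modulo `m`, so the middle coordinate is 1 - x
    -- - z.
    S : ℕ → ℕ → Triple
    S x z = x , 1 + (4 + n) * (x + z) , z

    S-layer : ∀ x z → size (S x z) ≋ 1
    S-layer x z = ≡+*⇒≋ (x + z) (rearrange n x z)
      where
      rearrange : ∀ n x z → x + (1 + (4 + n) * (x + z)) + z ≡ 1 + (x + z) * (5 + n)
      rearrange = solve-∀

    before : ℕ → ℕ → Triple
    before x z = add 1F (1 + n) (add 0F 1 (add 1F 2 (S x z)))

    lap : ∀ x z → f ⊢ pt (S x z) ⟶ pt (before x z)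
    lap x z = ⟶-trans (run 1F 2 (S x z) low (S-layer x z) 2<m)
      (⟶-trans (⟶⁺⇒⟶ (⟶-step (⟶-refl {f = f}) (step-pt (add 1F 2 (S x z)) at3 3<m refl)))
      (run 1F (1 + n) {4} (add 0F 1 (add 1F 2 (S x z))) (λ t q _ → high t q) at4
        (≤-reflexive (+-comm (1 + n) 4))))
      where
      low : ∀ t q → t < 2 → rule 1F (t + 1) q ≡ 1F
      low 0 (_ , zero  , _) _ = refl
      low 0 (_ , suc _ , _) _ = refl
      low 1 q _ = refl
      low (suc (suc t)) q (s≤s (s≤s ()))
      high : ∀ t q → rule 1F (t + 4) q ≡ 1F
      high t q rewrite +-comm t 4 = refl
      at3 : size (add 1F 2 (S x z)) ≋ 3
      at3 = ≋-trans (≡⇒≋ (size-add 1F 2 (S x z))) (+-≋ (≋-refl {2}) (S-layer x z))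
      at4 : size (add 0F 1 (add 1F 2 (S x z))) ≋ 4
      at4 = ≋-trans (≡⇒≋ (size-add 0F 1 (add 1F 2 (S x z)))) (+-≋ (≋-refl {1}) at3)

    before-layer : ∀ x z → size (before x z) ≋ 0
    before-layer x z = ≡+*⇒≋ (1 + (x + z)) (rearrange n x z)
      where
      rearrange : ∀ n x z → 1 + x + (1 + n + (2 + (1 + (4 + n) * (x + z)))) + z ≡ 0 + (1 + (x + z)) * (5 + n)
      rearrange = solve-∀

    -- Layer 3 raises x, and layer 0 then raises y unless the new x is 0, in which case it raises z.
    -- So (x , z) goes to (x + 1 , z), except that (m - 1 , z) goes to (0 , z + 1).
    return : ∀ x z → suc x < m → f ⊢ pt (S x z) ⟶⁺ pt (S (suc x) z)
    return x z x<m = subst (f ⊢ pt (S x z) ⟶⁺_)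
      (pt-cong (≋-refl {suc x}) (≡⇒≋ (rearrange n x z)) (≋-refl {z}))
      (⟶-step (lap x z) (step-pt {i = 1F} (before x z) (before-layer x z) 0<m
        (cong (λ a → rule 1F 0 (a , proj₂ (reduced (before x z)))) (≋⇒% (≋-refl {suc x}) x<m))))
      where
      rearrange : ∀ n x z → 1 + (1 + n + (2 + (1 + (4 + n) * (x + z)))) ≡ 1 + (4 + n) * (suc x + z)
      rearrange = solve-∀

    carry : ∀ z → f ⊢ pt (S (4 + n) z) ⟶⁺ pt (S 0 (suc z))
    carry z = subst (f ⊢ pt (S (4 + n) z) ⟶⁺_)
      (pt-cong m≋0 (≡+*⇒≋ {b = 1 + (4 + n) * suc z} (3 + n) (rearrange n z)) (≋-refl {suc z}))
      (⟶-step (lap (4 + n) z) (step-pt {i = 2F} (before (4 + n) z) (before-layer (4 + n) z) 0<m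
        (cong (λ a → rule 1F 0 (a , proj₂ (reduced (before (4 + n) z)))) (≋⇒% m≋0 0<m))))
      where
      rearrange : ∀ n z → 1 + n + (2 + (1 + (4 + n) * (4 + n + z))) ≡ 1 + (4 + n) * suc z + (3 + n) * (5 + n)
      rearrange = solve-∀

    o : V m
    o = pt (S 0 0)

    all : ∀ x z → x ≤ 4 + n → f ⊢ o ⟶ pt (S x z)
    all = odometer (λ x z → f ⊢ o ⟶ pt (S x z)) (4 + n)
      (λ x z x<k r → ⟶⁺⇒⟶ (⟶-⟶⁺-trans r (return x z (s≤s x<k))))
      (λ z r → ⟶⁺⇒⟶ (⟶-⟶⁺-trans r (carry z)))
      ⟶-refl

    closed : f ⊢ o ⟶⁺ o
    closed = subst (f ⊢ o ⟶⁺_)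
      (pt-cong (≋-refl {0}) (≡+*⇒≋ {b = 1 + (4 + n) * 0} (4 + n) (rearrange n)) m≋0)
      (⟶-⟶⁺-trans (all (4 + n) (4 + n) ≤-refl) (carry (4 + n)))
      where
      rearrange : ∀ n → 1 + (4 + n) * (5 + n) ≡ 1 + (4 + n) * 0 + (4 + n) * (5 + n)
      rearrange = solve-∀

    section : AllAt f o 1
    section v@(x , y , z) at1 = subst (f ⊢ o ⟶_)
      (trans (pt-cong (≋-refl {toℕ x}) y≋ (≋-refl {toℕ z})) (pt-coords v))
      (all (toℕ x) (toℕ z) (≤-pred (toℕ<n x)))
      where
      rearrange : ∀ x y z → x + z + y ≡ x + y + z
      rearrange = solve-∀
      y≋ : 1 + (4 + n) * (toℕ x + toℕ z) ≋ toℕ y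
      y≋ = ≋-+-cancelˡ (toℕ x + toℕ z) (≋-trans (≡⇒≋ (rearrange (toℕ x) _ (toℕ z)))
        (≋-trans (S-layer (toℕ x) (toℕ z))
        (≋-trans (≋-sym at1) (≡⇒≋ (sym (rearrange (toℕ x) (toℕ y) (toℕ z)))))))

    singleOrbit : SingleOrbit f
    singleOrbit = o , closed , cover 1 section onto
      where
      onto : ∀ k → 1 ≤ k → k < m → Onto f k
      onto 1 _ k<m = const-layer-onto 1F ≋-refl k<m λ { (_ , zero , _) → refl ; (_ , suc _ , _) → refl }
      onto 2 _ k<m = const-layer-onto 1F ≋-refl k<m λ _ → refl
      onto 3 _ k<m = const-layer-onto 0F ≋-refl k<m λ _ → refl
      onto (suc (suc (suc (suc k)))) _ k<m = const-layer-onto 1F ≋-refl k<m λ _ → refl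

  -- The return map of colour 2

  module Colour₂ where

    open Rule (rule 2F)

    f : V m → V m
    f = step d

    S : ℕ → ℕ → Triple
    S y z = 2 + (4 + n) * (y + z) , y , z

    S-layer : ∀ y z → size (S y z) ≋ 2
    S-layer y z = ≡+*⇒≋ (y + z) (rearrange n y z)
      where
      rearrange : ∀ n y z → 2 + (4 + n) * (y + z) + y + z ≡ 2 + (y + z) * (5 + n)
      rearrange = solve-∀

    layer0 : ∀ q → rule 2F 0 q ≡ 0F
    layer0 (zero  , _ , _) = refl
    layer0 (suc _ , _ , _) = refl

    before : ℕ → ℕ → Triple
    before y z = add 0F 1 (add 0F (1 + n) (add 1F 1 (add 2F 1 (S y z))))

    lap : ∀ y z → f ⊢ pt (S y z) ⟶ pt (before y z)
    lap y z = ⟶-trans (⟶⁺⇒⟶ (⟶-step (⟶-refl {f = f}) (step-pt (S y z) (S-layer y z) 2<m refl)))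
      (⟶-trans (⟶⁺⇒⟶ (⟶-step (⟶-refl {f = f}) (step-pt (add 2F 1 (S y z)) at3 3<m refl)))
      (⟶⁺⇒⟶ (⟶-step (run 0F (1 + n) {4} p₄ (λ t q _ → high t q) at4 (≤-reflexive (+-comm (1 + n) 4)))
        (step-pt (add 0F (1 + n) p₄) at0 0<m (layer0 (reduced (add 0F (1 + n) p₄)))))))
      where
      p₄ : Triple
      p₄ = add 1F 1 (add 2F 1 (S y z))
      high : ∀ t q → rule 2F (t + 4) q ≡ 0F
      high t q rewrite +-comm t 4 = refl
      at3 : size (add 2F 1 (S y z)) ≋ 3
      at3 = ≋-trans (≡⇒≋ (size-add 2F 1 (S y z))) (+-≋ (≋-refl {1}) (S-layer y z))
      at4 : size p₄ ≋ 4
      at4 = ≋-trans (≡⇒≋ (size-add 1F 1 (add 2F 1 (S y z)))) (+-≋ (≋-refl {1}) at3)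
      at0 : size (add 0F (1 + n) p₄) ≋ 0
      at0 = ≋-trans (≡⇒≋ (size-add 0F (1 + n) p₄))
        (≋-trans (+-≋ (≋-refl {1 + n}) at4) (≋-trans (≡⇒≋ (+-comm (1 + n) 4)) m≋0))

    before-layer : ∀ y z → size (before y z) ≋ 1
    before-layer y z = ≡+*⇒≋ (1 + (y + z)) (rearrange n y z)
      where
      rearrange : ∀ n y z → 1 + (1 + n + (2 + (4 + n) * (y + z))) + (1 + y) + (1 + z) ≡ 1 + (1 + (y + z)) * (5 + n)
      rearrange = solve-∀

    -- Layers 2 and 3 raise z and y; layer 1 then raises x unless the new y is 0, in which case it
    -- raises z again. So (y , z) goes to (y + 1 , z + 1), except that (m - 1 , z) goes to (0 , z +
    -- 2).
    return : ∀ y z → suc y < m → f ⊢ pt (S y z) ⟶⁺ pt (S (suc y) (suc z))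
    return y z y<m = subst (f ⊢ pt (S y z) ⟶⁺_)
      (pt-cong (≋-sym (≡+*⇒≋ {b = 2 + (1 + n + (2 + (4 + n) * (y + z)))} 1 (rearrange n y z)))
        (≋-refl {suc y}) (≋-refl {suc z}))
      (⟶-step (lap y z) (step-pt {i = 0F} (before y z) (before-layer y z) 1<m
        (cong (λ b → rule 2F 1 (proj₁ (reduced (before y z)) , b , suc z % m)) (≋⇒% (≋-refl {suc y}) y<m))))
      where
      rearrange : ∀ n y z → 2 + (4 + n) * (suc y + suc z) ≡ 2 + (1 + n + (2 + (4 + n) * (y + z))) + 1 * (5 + n)
      rearrange = solve-∀

    carry : ∀ z → f ⊢ pt (S (4 + n) z) ⟶⁺ pt (S 0 (suc (suc z)))
    carry z = subst (f ⊢ pt (S (4 + n) z) ⟶⁺_)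
      (pt-cong (≡+*⇒≋ {b = 2 + (4 + n) * suc (suc z)} (2 + n) (rearrange n z)) m≋0 (≋-refl {suc (suc z)}))
      (⟶-step (lap (4 + n) z) (step-pt {i = 2F} (before (4 + n) z) (before-layer (4 + n) z) 1<m
        (cong (λ b → rule 2F 1 (proj₁ (reduced (before (4 + n) z)) , b , suc z % m)) (≋⇒% m≋0 0<m))))
      where
      rearrange : ∀ n z → 1 + (1 + n + (2 + (4 + n) * (4 + n + z))) ≡ 2 + (4 + n) * suc (suc z) + (2 + n) * (5 + n)
      rearrange = solve-∀

    o : V m
    o = pt (S 0 0)

    S-period : ∀ y z k → pt (S y (z + k * m)) ≡ pt (S y z)
    S-period y z k = pt-cong (≡+*⇒≋ {b = 2 + (4 + n) * (y + z)} ((4 + n) * k) (rearrange n y z k))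
      (≋-refl {y}) (+*-≋ z k)
      where
      rearrange : ∀ n y z k → 2 + (4 + n) * (y + (z + k * (5 + n))) ≡ 2 + (4 + n) * (y + z) + (4 + n) * k * (5 + n)
      rearrange = solve-∀

    -- During `m` returns z grows by `m + 1`, so the slow digit, here called `z`, increases by one.
    carry-drift : ∀ z → pt (S 0 (suc (suc (z + (4 + n))))) ≡ pt (S 0 (suc z + 0))
    carry-drift z = trans (cong (λ t → pt (S 0 t)) (rearrange n z)) (S-period 0 (suc z + 0) 1)
      where
      rearrange : ∀ n z → suc (suc (z + (4 + n))) ≡ suc z + 0 + 1 * (5 + n)
      rearrange = solve-∀

    -- Along the section z grows together with y, and z − y is the slow digit of the odometer.
    all : ∀ y t → y ≤ 4 + n → f ⊢ o ⟶ pt (S y (t + y))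
    all = odometer (λ y t → f ⊢ o ⟶ pt (S y (t + y))) (4 + n)
      (λ y t y<k r → subst (λ z → f ⊢ o ⟶ pt (S (suc y) z)) (sym (+-suc t y))
        (⟶⁺⇒⟶ (⟶-⟶⁺-trans r (return y (t + y) (s≤s y<k)))))
      (λ t r → subst (f ⊢ o ⟶_) (carry-drift t) (⟶⁺⇒⟶ (⟶-⟶⁺-trans r (carry (t + (4 + n))))))
      ⟶-refl

    closed : f ⊢ o ⟶⁺ o
    closed = subst (f ⊢ o ⟶⁺_)
      (trans (carry-drift (4 + n)) (trans (cong (λ t → pt (S 0 t)) (rearrange n)) (S-period 0 0 1)))
      (⟶-⟶⁺-trans (all (4 + n) (4 + n) ≤-refl) (carry (4 + n + (4 + n))))
      where
      rearrange : ∀ n → suc (4 + n) + 0 ≡ 0 + 1 * (5 + n)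
      rearrange = solve-∀

    section : AllAt f o 2
    section v@(x , y , z) at2 = subst (f ⊢ o ⟶_)
      (trans (cong (λ t → pt (S (toℕ y) t)) (rearrange n (toℕ y) (toℕ z)))
      (trans (S-period (toℕ y) (toℕ z) (toℕ y))
      (trans (pt-cong x≋ (≋-refl {toℕ y}) (≋-refl {toℕ z})) (pt-coords v))))
      -- The slow digit z - y, with `4 + n` in place of -1.
      (all (toℕ y) (toℕ z + (4 + n) * toℕ y) (≤-pred (toℕ<n y)))
      where
      rearrange : ∀ n y z → z + (4 + n) * y + y ≡ z + y * (5 + n)
      rearrange = solve-∀
      rearrange′ : ∀ x y z → y + z + x ≡ x + y + z
      rearrange′ = solve-∀
      x≋ : 2 + (4 + n) * (toℕ y + toℕ z) ≋ toℕ x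
      x≋ = ≋-+-cancelˡ (toℕ y + toℕ z) (≋-trans (≡⇒≋ (rearrange′ _ (toℕ y) (toℕ z)))
        (≋-trans (S-layer (toℕ y) (toℕ z))
        (≋-trans (≋-sym at2) (≡⇒≋ (sym (rearrange′ (toℕ x) (toℕ y) (toℕ z)))))))

    singleOrbit : SingleOrbit f
    singleOrbit = o , closed , cover 2 section onto
      where
      onto : ∀ k → 2 ≤ k → k < 2 + (4 + n) → Onto f k
      onto k 2≤k k<1+m with m≤n⇒m<n∨m≡n (≤-pred k<1+m)
      ... | inj₂ refl = const-layer-onto 0F m≋0 0<m layer0
      onto 1 (s≤s ()) _ | inj₁ _
      onto 2 _ _ | inj₁ k<m = const-layer-onto 2F ≋-refl k<m λ _ → refl
      onto 3 _ _ | inj₁ k<m = const-layer-onto 1F ≋-refl k<m λ _ → refl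
      onto (suc (suc (suc (suc k)))) _ _ | inj₁ k<m = const-layer-onto 0F ≋-refl k<m λ _ → refl

  -- The return map of colour 0, where the parity of m enters

  module Colour₀ (h : ℕ) (n≡h*2 : n ≡ h * 2) where

    open Rule (rule 0F)

    f : V m → V m
    f = step d

    S : ℕ → ℕ → Triple
    S x y = x , y , 2 + (4 + n) * (x + y)

    S-layer : ∀ x y → size (S x y) ≋ 2
    S-layer x y = ≡+*⇒≋ (x + y) (rearrange n x y)
      where
      rearrange : ∀ n x y → x + y + (2 + (4 + n) * (x + y)) ≡ 2 + (x + y) * (5 + n)
      rearrange = solve-∀

    S-period : ∀ x y k l → pt (S (x + k * m) (y + l * m)) ≡ pt (S x y)
    S-period x y k l = pt-cong (+*-≋ x k) (+*-≋ y l)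
      (≡+*⇒≋ {b = 2 + (4 + n) * (x + y)} ((4 + n) * (k + l)) (rearrange n x y k l))
      where
      rearrange : ∀ n x y k l → 2 + (4 + n) * (x + k * (5 + n) + (y + l * (5 + n))) ≡
        2 + (4 + n) * (x + y) + (4 + n) * (k + l) * (5 + n)
      rearrange = solve-∀

    before : ℕ → ℕ → Triple
    before x y = add 2F (2 + n) (add 0F 1 (S x y))

    lap : ∀ x y → f ⊢ pt (S x y) ⟶ pt (before x y)
    lap x y = ⟶-trans (⟶⁺⇒⟶ (⟶-step (⟶-refl {f = f}) (step-pt (S x y) (S-layer x y) 2<m refl)))
      (run 2F (2 + n) {3} (add 0F 1 (S x y)) (λ t q _ → high t q) at3 (≤-reflexive (+-comm (2 + n) 3)))
      where
      high : ∀ t q → rule 0F (t + 3) q ≡ 2F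
      high 0 q = refl
      high (suc t) q rewrite +-comm t 3 = refl
      at3 : size (add 0F 1 (S x y)) ≋ 3
      at3 = ≋-trans (≡⇒≋ (size-add 0F 1 (S x y))) (+-≋ (≋-refl {1}) (S-layer x y))

    before-layer : ∀ x y → size (before x y) ≋ 0
    before-layer x y = ≡+*⇒≋ (1 + (x + y)) (rearrange n x y)
      where
      rearrange : ∀ n x y → 1 + x + y + (2 + n + (2 + (4 + n) * (x + y))) ≡ 0 + (1 + (x + y)) * (5 + n)
      rearrange = solve-∀

    -- Layer 2 raises x; layer 0 then tests the new x, and layer 1 the resulting y. For x ≠ m - 1
    -- the point (x , y) goes to (x + 1 , y) if y ≠ 0 and to (x + 2 , 0) if y = 0; (m - 1 , y) goes
    -- to (0 , y + 1), except that (m - 1 , m - 1) goes to (1 , 0).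
    return : ∀ x y i j → rule 0F 0 (reduced (before x y)) ≡ i → rule 0F 1 (reduced (add i 1 (before x y))) ≡ j →
      f ⊢ pt (S x y) ⟶⁺ pt (add j 1 (add i 1 (before x y)))
    return x y i j rule₀ rule₁ = ⟶-step {f = f}
      (⟶⁺⇒⟶ (⟶-step (lap x y) (step-pt (before x y) (before-layer x y) 0<m rule₀)))
      (step-pt (add i 1 (before x y)) (≋-trans (≡⇒≋ (size-add i 1 (before x y))) (+-≋ (≋-refl {1}) (before-layer x y)))
        1<m rule₁)

    rule₀ : ∀ {a b} c → a ≋ b → b < m → rule 0F 0 (a % m , c) ≡ rule 0F 0 (b , c)
    rule₀ c a≋b b<m = cong (λ a → rule 0F 0 (a , c)) (≋⇒% a≋b b<m)

    rule₁ : ∀ {a b} c e → a ≋ b → b < m → rule 0F 1 (c , a % m , e) ≡ rule 0F 1 (c , b , e)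
    rule₁ c e a≋b b<m = cong (λ a → rule 0F 1 (c , a , e)) (≋⇒% a≋b b<m)

    o : V m
    o = pt (S 0 1)

    At : ℕ → ℕ → Set
    At x y = f ⊢ o ⟶ pt (S x y)

    along : ∀ {x y} → suc x < m → suc y < m → At x (suc y) → At (suc x) (suc y)
    along {x} {y} x<m y<m r = ⟶⁺⇒⟶ (⟶-⟶⁺-trans r (subst (f ⊢ pt (S x (suc y)) ⟶⁺_)
      (pt-cong (≋-refl {suc x}) (≋-refl {suc y}) (≡⇒≋ (rearrange n x (suc y))))
      (return x (suc y) 2F 2F
        (rule₀ (proj₂ (reduced (before x (suc y)))) (≋-refl {suc x}) x<m)
        (rule₁ (suc x % m) _ (≋-refl {suc y}) y<m))))
      where
      rearrange : ∀ n x y → 1 + (1 + (2 + n + (2 + (4 + n) * (x + y)))) ≡ 2 + (4 + n) * (suc x + y)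
      rearrange = solve-∀

    along-zero : ∀ {x} → suc x < m → At x 0 → At (suc (suc x)) 0
    along-zero {x} x<m r = ⟶⁺⇒⟶ (⟶-⟶⁺-trans r (subst (f ⊢ pt (S x 0) ⟶⁺_)
      (pt-cong (≋-refl {suc (suc x)}) (≋-refl {0})
        (≋-sym (≡+*⇒≋ {b = 1 + (2 + n + (2 + (4 + n) * (x + 0)))} 1 (rearrange n x))))
      (return x 0 2F 0F (rule₀ (proj₂ (reduced (before x 0))) (≋-refl {suc x}) x<m) refl)))
      where
      rearrange : ∀ n x → 2 + (4 + n) * (suc (suc x) + 0) ≡ 1 + (2 + n + (2 + (4 + n) * (x + 0))) + 1 * (5 + n)
      rearrange = solve-∀

    exit : ∀ {y} → suc y < m → f ⊢ pt (S (4 + n) y) ⟶⁺ pt (S 0 (suc y))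
    exit {y} y<m = subst (f ⊢ pt (S (4 + n) y) ⟶⁺_)
      (pt-cong m≋0 (≋-refl {suc y}) (≡+*⇒≋ {b = 2 + (4 + n) * (0 + suc y)} (3 + n) (rearrange n y)))
      (return (4 + n) y 1F 2F
        (rule₀ (proj₂ (reduced (before (4 + n) y))) m≋0 0<m)
        (rule₁ (m % m) _ (≋-refl {suc y}) y<m))
      where
      rearrange : ∀ n y → 1 + (2 + n + (2 + (4 + n) * (4 + n + y))) ≡ 2 + (4 + n) * (0 + suc y) + (3 + n) * (5 + n)
      rearrange = solve-∀

    exit-last : f ⊢ pt (S (4 + n) (4 + n)) ⟶⁺ pt (S 1 0)
    exit-last = subst (f ⊢ pt (S (4 + n) (4 + n)) ⟶⁺_)
      (pt-cong (+-≋ (≋-refl {1}) m≋0) m≋0 (≡+*⇒≋ {b = 2 + (4 + n) * (1 + 0)} (6 + 2 * n) (rearrange n)))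
      (return (4 + n) (4 + n) 1F 0F
        (rule₀ (proj₂ (reduced (before (4 + n) (4 + n)))) m≋0 0<m)
        (rule₁ (m % m) _ m≋0 0<m))
      where
      rearrange : ∀ n → 2 + n + (2 + (4 + n) * (4 + n + (4 + n))) ≡ 2 + (4 + n) * (1 + 0) + (6 + 2 * n) * (5 + n)
      rearrange = solve-∀

    traverse : ∀ {y} → suc y < m → At 0 (suc y) → ∀ x → x < m → At x (suc y)
    traverse y<m r zero    _   = r
    traverse y<m r (suc x) x<m = along x<m y<m (traverse y<m r x (<⇒≤ x<m))

    entry : ∀ y → suc y < m → At 0 (suc y)
    entry zero    _   = ⟶-refl
    entry (suc y) y<m = ⟶⁺⇒⟶ (⟶-⟶⁺-trans (traverse (<⇒≤ y<m) (entry y (<⇒≤ y<m)) (4 + n) ≤-refl) (exit y<m))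

    -- Row 0 is entered at x = 1 and crossed in steps of two. As `m` is odd, this pass runs into x =
    -- m, that is 0, and a second pass meets the even x up to m - 1, where the row is left for the
    -- start.
    odds : ∀ j → j * 2 ≤ 4 + n → At (1 + j * 2) 0
    odds zero    _   = ⟶⁺⇒⟶ (⟶-⟶⁺-trans (traverse ≤-refl (entry (3 + n) ≤-refl) (4 + n) ≤-refl) exit-last)
    odds (suc j) j≤n = along-zero (s≤s j≤n) (odds j (<⇒≤ (<⇒≤ j≤n)))

    zero-zero : At 0 0
    zero-zero = subst (f ⊢ o ⟶_) (trans (cong (λ x → pt (S x 0)) eq) (S-period 0 0 1 0))
      (odds (2 + h) (≤-reflexive (cong (4 +_) (sym n≡h*2))))
      where
      eq : 1 + (2 + h) * 2 ≡ 0 + 1 * m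
      eq = trans (cong (5 +_) (sym n≡h*2)) (sym (*-identityˡ m))

    evens : ∀ j → j * 2 < m → At (j * 2) 0
    evens zero    _   = zero-zero
    evens (suc j) j<m = along-zero (<⇒≤ j<m) (evens j (<⇒≤ (<⇒≤ j<m)))

    closed : f ⊢ o ⟶⁺ o
    closed = ⟶-⟶⁺-trans
      (subst (λ x → At x 0) (cong (4 +_) (sym n≡h*2)) (evens (2 + h) (≤-reflexive (cong (5 +_) (sym n≡h*2)))))
      (exit 1<m)

    all : ∀ x y → x < m → y < m → At x y
    all x (suc y) x<m y<m = traverse y<m (entry y y<m) x x<m
    all x zero    x<m _   with parity x
    ... | j , inj₁ refl = evens j x<m
    ... | j , inj₂ refl = odds j (≤-pred (<⇒≤ x<m))

    section : AllAt f o 2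
    section v@(x , y , z) at2 = subst (f ⊢ o ⟶_)
      (trans (pt-cong (≋-refl {toℕ x}) (≋-refl {toℕ y}) z≋) (pt-coords v))
      (all (toℕ x) (toℕ y) (toℕ<n x) (toℕ<n y))
      where
      z≋ : 2 + (4 + n) * (toℕ x + toℕ y) ≋ toℕ z
      z≋ = ≋-+-cancelˡ (toℕ x + toℕ y) (≋-trans (S-layer (toℕ x) (toℕ y)) (≋-sym at2))

    -- In layer 0 the direction depends on x alone and is `1F` or `2F`, neither of which changes x;
    -- so the x of the target tells which arc enters it.
    onto-zero : Onto f m
    onto-zero (zero , y , z) at1 = u , layer--e v 1F at1 , step--e d v {1F} (cong (λ l → rule 0F l (coords u)) u-layer)
      where
      v : V m
      v = zero , y , z
      u : V m
      u = v -e 1F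
      u-layer : layer u % m ≡ 0
      u-layer = ≋⇒% (≋-trans (layer--e v 1F at1) m≋0) 0<m
    onto-zero (x@(suc _) , y , z) at1 = u , layer--e v 2F at1 ,
      step--e d v {2F} (trans (cong (λ l → rule 0F l (coords u)) u-layer) (nonzero x refl))
      where
      v : V m
      v = x , y , z
      u : V m
      u = v -e 2F
      u-layer : layer u % m ≡ 0
      u-layer = ≋⇒% (≋-trans (layer--e v 2F at1) m≋0) 0<m
      nonzero : ∀ x′ {c} → x′ ≡ x → rule 0F 0 (toℕ (toℕ x′ mod m) , c) ≡ 2F
      nonzero x′ eq rewrite mod-toℕ x′ | eq = refl

    singleOrbit : SingleOrbit f
    singleOrbit = o , closed , cover 2 section onto
      where
      onto : ∀ k → 2 ≤ k → k < 2 + (4 + n) → Onto f k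
      onto k 2≤k k<1+m with m≤n⇒m<n∨m≡n (≤-pred k<1+m)
      ... | inj₂ refl = onto-zero
      onto 1 (s≤s ()) _ | inj₁ _
      onto 2 _ _ | inj₁ k<m = const-layer-onto 0F ≋-refl k<m λ _ → refl
      onto 3 _ _ | inj₁ k<m = const-layer-onto 2F ≋-refl k<m λ _ → refl
      onto (suc (suc (suc (suc k)))) _ _ | inj₁ k<m = const-layer-onto 2F ≋-refl k<m λ _ → refl

  odd-decomposition : (h : ℕ) → n ≡ h * 2 → Decomposition m
  odd-decomposition h n≡h*2 = decomposition (λ c v → rule c (layer v % m) (coords v))
    (λ v → rule-injective (layer v % m) (coords v)) λ
    { 0F → Colour₀.singleOrbit h n≡h*2
    ; 1F → Colour₁.singleOrbit
    ; 2F → Colour₂.singleOrbit }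

-- Even m

-- T y z is the direction of colour 0 in the exceptional layer. In each row y the value 1 marks
-- the exit to row y + 1; off the rows 0, 2 and 4 it is the only entry different from 0. The
-- table is the translate, chosen so that all exceptional entries have constant coordinates, of
-- a pattern found by computer search for small m.
T : ℕ → ℕ → Fin 3
T 0 2 = 2F
T 0 3 = 2F
T 0 4 = 1F
T 1 4 = 1F
T 2 0 = 1F
T 2 (suc (suc (suc (suc _)))) = 2F
T 3 0 = 1F
T 4 0 = 2F
T 4 1 = 2F
T 4 2 = 1F
T (suc (suc (suc (suc (suc _))))) 2 = 1F
T _ _ = 0F

-- The Latin property of the exceptional layer

cap : ℕ → ℕ
cap (suc (suc (suc (suc (suc _))))) = 5
cap x = x

cap<6 : ∀ x → cap x < 6
cap<6 0 = s≤s z≤n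
cap<6 1 = s≤s (s≤s z≤n)
cap<6 2 = s≤s (s≤s (s≤s z≤n))
cap<6 3 = s≤s (s≤s (s≤s (s≤s z≤n)))
cap<6 4 = s≤s (s≤s (s≤s (s≤s (s≤s z≤n))))
cap<6 (suc (suc (suc (suc (suc _))))) = ≤-refl

cap<5⇒≡ : ∀ x → cap x < 5 → cap x ≡ x
cap<5⇒≡ 0 _ = refl
cap<5⇒≡ 1 _ = refl
cap<5⇒≡ 2 _ = refl
cap<5⇒≡ 3 _ = refl
cap<5⇒≡ 4 _ = refl
cap<5⇒≡ (suc (suc (suc (suc (suc _))))) 5<5 = contradiction 5<5 (n≮n 5)

-- `T` does not distinguish coordinates from 5 on, so capping reduces the check for all `m` at once
-- to 6³ triples; this bound then recovers x ≥ 5 from a capped value 5.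
cap≤ : ∀ x → cap x ≤ x
cap≤ 0 = ≤-refl
cap≤ 1 = ≤-refl
cap≤ 2 = ≤-refl
cap≤ 3 = ≤-refl
cap≤ 4 = ≤-refl
cap≤ (suc (suc (suc (suc (suc x))))) = m≤m+n 5 x

T-capˡ : ∀ y z → T (cap y) z ≡ T y z
T-capˡ 0 z = refl
T-capˡ 1 z = refl
T-capˡ 2 z = refl
T-capˡ 3 z = refl
T-capˡ 4 z = refl
T-capˡ (suc (suc (suc (suc (suc _))))) 0 = refl
T-capˡ (suc (suc (suc (suc (suc _))))) 1 = refl
T-capˡ (suc (suc (suc (suc (suc _))))) 2 = refl
T-capˡ (suc (suc (suc (suc (suc _))))) (suc (suc (suc _))) = refl

T-capʳ : ∀ y z → T y (cap z) ≡ T y z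
T-capʳ y 0 = refl
T-capʳ y 1 = refl
T-capʳ y 2 = refl
T-capʳ y 3 = refl
T-capʳ y 4 = refl
T-capʳ 0 (suc (suc (suc (suc (suc _))))) = refl
T-capʳ 1 (suc (suc (suc (suc (suc _))))) = refl
T-capʳ 2 (suc (suc (suc (suc (suc _))))) = refl
T-capʳ 3 (suc (suc (suc (suc (suc _))))) = refl
T-capʳ 4 (suc (suc (suc (suc (suc _))))) = refl
T-capʳ (suc (suc (suc (suc (suc _))))) (suc (suc (suc (suc (suc _))))) = refl

T-cap : ∀ y z → T (cap y) (cap z) ≡ T y z
T-cap y z = trans (T-capˡ y (cap z)) (T-capʳ y z)

TLatin : ℕ → ℕ → ℕ → Set
TLatin x y z = AllDistinct (T y z) (inc (T z x)) (inc (inc (T x y)))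

Strictly : ℕ → ℕ → ℕ → Set
Strictly a t b = a < t × t < b

OneLarge : ℕ → ℕ → ℕ → Set
OneLarge x y z = x ≡ 5 × y < 5 × z < 5 × Strictly 1 (y + z) 7

-- Capped coordinates of vertices that cannot satisfy x + y + z ≡ 6 modulo m, the equation of
-- the exceptional layer.
OffLayer : ℕ → ℕ → ℕ → Set
OffLayer x y z =
  (x < 5 × y < 5 × z < 5 × (Strictly 0 (x + y + z) 6 ⊎ Strictly 6 (x + y + z) 12))
  ⊎ OneLarge x y z ⊎ OneLarge y z x ⊎ OneLarge z x y

LatinOrOff : ℕ → ℕ → ℕ → Set
LatinOrOff x y z = TLatin x y z ⊎ OffLayer x y z

T-latin-capped : ∀ (i j k : Fin 6) → LatinOrOff (toℕ i) (toℕ j) (toℕ k)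
T-latin-capped = toWitness {a? = all? λ i → all? λ j → all? λ k → check (toℕ i) (toℕ j) (toℕ k)} tt
  where
  strictly? : ∀ a t b → Dec (Strictly a t b)
  strictly? a t b = (a <? t) ×-dec (t <? b)
  oneLarge? : ∀ x y z → Dec (OneLarge x y z)
  oneLarge? x y z = (x ≟ℕ 5) ×-dec (y <? 5) ×-dec (z <? 5) ×-dec strictly? 1 (y + z) 7
  check : ∀ x y z → Dec (LatinOrOff x y z)
  check x y z = allDistinct? _ _ _ ⊎-dec
    (((x <? 5) ×-dec (y <? 5) ×-dec (z <? 5) ×-dec (strictly? 0 (x + y + z) 6 ⊎-dec strictly? 6 (x + y + z) 12))
    ⊎-dec oneLarge? x y z ⊎-dec oneLarge? y z x ⊎-dec oneLarge? z x y)

between-multiples : ∀ q a m .{{_ : NonZero m}} → q * m < a → a < suc q * m → a % m ≢ 0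
between-multiples q a m lo hi eq = <-irrefl refl (<-≤-trans q<a/m (≤-pred a/m<1+q))
  where
  a≡ : a ≡ a / m * m
  a≡ = trans (m≡m%n+[m/n]*n a m) (cong (_+ a / m * m) eq)
  q<a/m : q < a / m
  q<a/m = *-cancelʳ-< m q (a / m) (subst (q * m <_) a≡ lo)
  a/m<1+q : a / m < suc q
  a/m<1+q = *-cancelʳ-< m (a / m) (suc q) (subst (_< suc q * m) a≡ hi)

module Even (n : ℕ) where

  open Layered (5 + n) n

  -- Since `m = n + 6`, the number `n + t` lies strictly between consecutive multiples of `m`. The
  -- sums 0 and 12 must stay out: they belong to the layer when `m` is 6.
  small-offLayer : ∀ t → Strictly 0 t 6 ⊎ Strictly 6 t 12 → (n + t) % m ≢ 0
  small-offLayer t (inj₁ (0<t , t<6)) = between-multiples 0 (n + t) m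
    (<-≤-trans 0<t (m≤n+m t n))
    (subst (n + t <_) (trans (+-comm n 6) (sym (*-identityˡ m))) (+-monoʳ-< n t<6))
  small-offLayer t (inj₂ (6<t , t<12)) = between-multiples 1 (n + t) m
    (subst (_< n + t) (trans (+-comm n 6) (sym (*-identityˡ m))) (+-monoʳ-< n 6<t))
    (<-≤-trans (+-monoʳ-< n t<12) (subst (n + 12 ≤_) (sym (rearrange n)) (m≤m+n (n + 12) n)))
    where
    rearrange : ∀ n → 2 * (6 + n) ≡ n + 12 + n
    rearrange = solve-∀

  -- Here 5 ≤ x ≤ m - 1 and 2 ≤ y + z ≤ 6, so x + y + z lies strictly between 6 and m + 6.
  large-offLayer : ∀ x y z → cap x ≡ 5 → x < m → cap y < 5 → cap z < 5 → Strictly 1 (cap y + cap z) 7 →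
    (n + (x + y + z)) % m ≢ 0
  large-offLayer x y z x≡5 x<m y<5 z<5 (1<u , u<7) =
    subst (λ t → (n + t) % m ≢ 0)
      (trans (cong₂ (λ b c → x + (b + c)) (cap<5⇒≡ y y<5) (cap<5⇒≡ z z<5)) (sym (+-assoc x y z)))
      (between-multiples 1 (n + (x + u)) m
        (subst (_≤ n + (x + u)) (lo n) (+-monoʳ-≤ n (+-mono-≤ (subst (_≤ x) x≡5 (cap≤ x)) 1<u)))
        (subst (n + (x + u) <_) (hi n) (+-monoʳ-< n (+-mono-≤-< (≤-pred x<m) u<7))))
    where
    u : ℕ
    u = cap y + cap z
    lo : ∀ n → n + (5 + 2) ≡ suc (1 * (6 + n))
    lo = solve-∀
    hi : ∀ n → n + (5 + n + 7) ≡ 2 * (6 + n)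
    hi = solve-∀

  rotate-sum : ∀ x y z → y + z + x ≡ x + y + z
  rotate-sum = solve-∀

  T-latin : ∀ x y z → x < m → y < m → z < m → (n + (x + y + z)) % m ≡ 0 → TLatin x y z
  T-latin x y z x<m y<m z<m eq with latin-or-off
    where
    latin-or-off : LatinOrOff (cap x) (cap y) (cap z)
    latin-or-off = subst (λ i → LatinOrOff i (cap y) (cap z)) (toℕ-fromℕ< (cap<6 x))
      (subst (λ j → LatinOrOff (toℕ (fromℕ< (cap<6 x))) j (cap z)) (toℕ-fromℕ< (cap<6 y))
      (subst (λ k → LatinOrOff (toℕ (fromℕ< (cap<6 x))) (toℕ (fromℕ< (cap<6 y))) k) (toℕ-fromℕ< (cap<6 z))
      (T-latin-capped (fromℕ< (cap<6 x)) (fromℕ< (cap<6 y)) (fromℕ< (cap<6 z)))))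
  ... | inj₁ latin rewrite T-cap y z | T-cap z x | T-cap x y = latin
  ... | inj₂ (inj₁ (x<5 , y<5 , z<5 , off))
    rewrite cap<5⇒≡ x x<5 | cap<5⇒≡ y y<5 | cap<5⇒≡ z z<5 = contradiction eq (small-offLayer (x + y + z) off)
  ... | inj₂ (inj₂ (inj₁ (x≡5 , y<5 , z<5 , u))) =
    contradiction eq (large-offLayer x y z x≡5 x<m y<5 z<5 u)
  ... | inj₂ (inj₂ (inj₂ (inj₁ (y≡5 , z<5 , x<5 , u)))) =
    contradiction (trans (cong (λ t → (n + t) % m) (rotate-sum x y z)) eq) (large-offLayer y z x y≡5 y<m z<5 x<5 u)
  ... | inj₂ (inj₂ (inj₂ (inj₂ (z≡5 , x<5 , y<5 , u)))) =
    contradiction (trans (cong (λ t → (n + t) % m) (sym (rotate-sum z x y))) eq) (large-offLayer z x y z≡5 z<m x<5 y<5 u)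

  δ : ℕ → Triple → Fin 3
  δ 0 (x , y , z) = T y z
  δ 1 _           = 2F
  δ _ _           = 0F

  open Rule δ

  -- Rotation preserves the layer, so all three colours read the same clause of `δ`; outside layer 0
  -- they take the three shifts of one constant.
  d-latin : ∀ v → RotationLatin d v
  d-latin (x , y , z) rewrite rotate-sum (toℕ x) (toℕ y) (toℕ z) | sym (rotate-sum (toℕ z) (toℕ x) (toℕ y))
    with (n + (toℕ x + toℕ y + toℕ z)) % m in eq
  ... | 0 = T-latin (toℕ x) (toℕ y) (toℕ z) (toℕ<n x) (toℕ<n y) (toℕ<n z) eq
  ... | 1 = (λ ()) , (λ ()) , (λ ())
  ... | suc (suc _) = (λ ()) , (λ ()) , (λ ())

-- The orbit of colour 0 for even m, row by row

module EvenOrbit (h : ℕ) where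

  n : ℕ
  n = h * 2

  open Layered (5 + n) n
  open Even n using (δ; d-latin)
  open Rule δ

  f : V m → V m
  f = step d

  -- The point of layer 1 with the given y and z: (5 + n) * (y + z) stands for −(y + z).
  S : ℕ → ℕ → Triple
  S y z = 7 + (5 + n) * (y + z) , y , z

  S-layer : ∀ y z → n + size (S y z) ≋ 1
  S-layer y z = ≡+*⇒≋ (1 + (y + z)) (rearrange n y z)
    where
    rearrange : ∀ n y z → n + (7 + (5 + n) * (y + z) + y + z) ≡ 1 + (1 + (y + z)) * (6 + n)
    rearrange = solve-∀

  S-period₁ : ∀ y z → pt (S (y + m) z) ≡ pt (S y z)
  S-period₁ y z = pt-cong (≡+*⇒≋ {b = 7 + (5 + n) * (y + z)} (5 + n) (rearrange n y z)) (+m-≋ y) (≋-refl {z})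
    where
    rearrange : ∀ n y z → 7 + (5 + n) * (y + (6 + n) + z) ≡ 7 + (5 + n) * (y + z) + (5 + n) * (6 + n)
    rearrange = solve-∀

  S-period₂ : ∀ y z → pt (S y (z + m)) ≡ pt (S y z)
  S-period₂ y z = pt-cong (≡+*⇒≋ {b = 7 + (5 + n) * (y + z)} (5 + n) (rearrange n y z)) (≋-refl {y}) (+m-≋ z)
    where
    rearrange : ∀ n y z → 7 + (5 + n) * (y + (z + (6 + n))) ≡ 7 + (5 + n) * (y + z) + (5 + n) * (6 + n)
    rearrange = solve-∀

  before : ℕ → ℕ → Triple
  before y z = add 0F (4 + n) (add 2F 1 (S y z))

  before-layer : ∀ y z → n + size (before y z) ≋ 0
  before-layer y z = ≡+*⇒≋ (2 + (y + z)) (rearrange n y z)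
    where
    rearrange : ∀ n y z → n + (4 + n + (7 + (5 + n) * (y + z)) + y + (1 + z)) ≡ 0 + (2 + (y + z)) * (6 + n)
    rearrange = solve-∀

  lap : ∀ y z → f ⊢ pt (S y z) ⟶ pt (before y z)
  lap y z = ⟶-trans (⟶⁺⇒⟶ (⟶-step (⟶-refl {f = f}) (step-pt (S y z) (S-layer y z) (s≤s (s≤s z≤n)) refl)))
    (run 0F (4 + n) {2} (add 2F 1 (S y z)) (λ t q _ → const t q) (≡+*⇒≋ (1 + (y + z)) (rearrange n y z))
      (≤-reflexive (+-comm (4 + n) 2)))
    where
    const : ∀ t q → δ (t + 2) q ≡ 0F
    const t q rewrite +-comm t 2 = refl
    rearrange : ∀ n y z → n + (7 + (5 + n) * (y + z) + y + (1 + z)) ≡ 2 + (1 + (y + z)) * (6 + n)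
    rearrange = solve-∀

  -- Layer 1 raises z, the others raise x until layer 0 reads `T y r` with `r` the reduced z + 1. So
  -- (y , z) goes to (y , z + 1), (y + 1 , z + 1) or (y , z + 2) as this entry is 0, 1 or 2.
  return : ∀ y z i {r} → y < m → suc z ≋ r → r < m → T y r ≡ i →
    f ⊢ pt (S y z) ⟶⁺ pt (add i 1 (before y z))
  return y z i {r} y<m z≋r r<m T≡i = ⟶-step (lap y z) (step-pt (before y z) (before-layer y z) z<s
    (trans (cong₂ T (m<n⇒m%n≡m y<m) (≋⇒% z≋r r<m)) T≡i))

  return₀ : ∀ y z {r} → y < m → suc z ≋ r → r < m → T y r ≡ 0F → f ⊢ pt (S y z) ⟶⁺ pt (S y (suc z))
  return₀ y z y<m p q T≡ = subst (f ⊢ pt (S y z) ⟶⁺_)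
    (pt-cong (≡⇒≋ (rearrange n y z)) (≋-refl {y}) (≋-refl {suc z})) (return y z 0F y<m p q T≡)
    where
    rearrange : ∀ n y z → 1 + (4 + n + (7 + (5 + n) * (y + z))) ≡ 7 + (5 + n) * (y + suc z)
    rearrange = solve-∀

  return₁ : ∀ y z {r} → y < m → suc z ≋ r → r < m → T y r ≡ 1F → f ⊢ pt (S y z) ⟶⁺ pt (S (suc y) (suc z))
  return₁ y z y<m p q T≡ = subst (f ⊢ pt (S y z) ⟶⁺_)
    (pt-cong (≋-sym (≡+*⇒≋ {b = 4 + n + (7 + (5 + n) * (y + z))} 1 (rearrange n y z))) (≋-refl {suc y}) (≋-refl {suc z})) (return y z 1F y<m p q T≡)
    where
    rearrange : ∀ n y z → 7 + (5 + n) * (suc y + suc z) ≡ 4 + n + (7 + (5 + n) * (y + z)) + 1 * (6 + n)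
    rearrange = solve-∀

  return₂ : ∀ y z {r} → y < m → suc z ≋ r → r < m → T y r ≡ 2F → f ⊢ pt (S y z) ⟶⁺ pt (S y (suc (suc z)))
  return₂ y z y<m p q T≡ = subst (f ⊢ pt (S y z) ⟶⁺_)
    (pt-cong (≋-sym (≡+*⇒≋ {b = 4 + n + (7 + (5 + n) * (y + z))} 1 (rearrange n y z))) (≋-refl {y}) (≋-refl {suc (suc z)})) (return y z 2F y<m p q T≡)
    where
    rearrange : ∀ n y z → 7 + (5 + n) * (y + suc (suc z)) ≡ 4 + n + (7 + (5 + n) * (y + z)) + 1 * (6 + n)
    rearrange = solve-∀

  o : V m
  o = pt (S 5 2)

  At : ℕ → ℕ → Set
  At y z = f ⊢ o ⟶ pt (S y z)

  infixl 1 _▷_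
  _▷_ : ∀ {u v w} → f ⊢ u ⟶ v → f ⊢ v ⟶⁺ w → f ⊢ u ⟶ w
  r ▷ s = ⟶-trans r (⟶⁺⇒⟶ s)

  wrap-z : ∀ y z → At y (z + m) → At y z
  wrap-z y z = subst (f ⊢ o ⟶_) (S-period₂ y z)

  0<m : 0 < m
  0<m = z<s
  1<m : 1 < m
  1<m = s<s z<s
  2<m : 2 < m
  2<m = s<s (s<s z<s)
  3<m : 3 < m
  3<m = s<s (s<s (s<s z<s))
  4<m : 4 < m
  4<m = s<s (s<s (s<s (s<s z<s)))

  advance : ∀ {y z} → y < m → suc z < m → T y (suc z) ≡ 0F → At y z → At y (suc z)
  advance {y} {z} y<m z<m T≡ r = r ▷ return₀ y z y<m ≋-refl z<m T≡

  advance* : ∀ {y z} j → y < m → (∀ t → T y (t + suc z) ≡ 0F) → j + z < m → At y z → At y (j + z)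
  advance* zero    y<m T≡ j+z<m r = r
  advance* {y} {z} (suc j) y<m T≡ j+z<m r = advance y<m j+z<m (trans (cong (T y) (sym (+-suc j z))) (T≡ j))
    (advance* j y<m T≡ (<⇒≤ j+z<m) r)

  last : ℕ
  last = 5 + n

  wrap₀ : ∀ {y} → y < m → T y 0 ≡ 0F → At y last → At y 0
  wrap₀ {y} y<m T≡ r = wrap-z y 0 (r ▷ return₀ y last y<m m≋0 0<m T≡)

  Row : ℕ → Set
  Row y = ∀ z → z < m → At y z

  module GenericRow (w : ℕ) (y<m : 5 + w < m) (start : At (5 + w) 2) where

    T≡0 : ∀ t → T (5 + w) (t + 3) ≡ 0F
    T≡0 t rewrite +-comm t 3 = refl

    upper : ∀ j → j + 2 < m → At (5 + w) (j + 2)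
    upper j j<m = advance* j y<m T≡0 j<m start

    at0 : At (5 + w) 0
    at0 = wrap₀ y<m refl (subst (At (5 + w)) eq (upper (3 + n) (≤-reflexive (cong suc eq))))
      where
      eq : 3 + n + 2 ≡ 5 + n
      eq = +-comm (3 + n) 2

    at1 : At (5 + w) 1
    at1 = advance y<m 1<m refl at0

    -- Order of visit: 2, 3, ..., m - 1, 0, 1; the exit from 1 enters the next row at 2 again.
    row : Row (5 + w)
    row 0 _ = at0
    row 1 _ = at1
    row (suc (suc z)) z<m = subst (At (5 + w)) (+-comm z 2) (upper z (subst (_< m) (+-comm 2 z) z<m))

    next : At (6 + w) 2
    next = at1 ▷ return₁ (5 + w) 1 y<m ≋-refl 2<m refl

  generic-start : ∀ w → w ≤ suc n → At (5 + w) 2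
  generic-start zero    _   = ⟶-refl
  generic-start (suc w) w≤n = subst (λ y → At y 2) (sym (+-suc 5 w))
    (GenericRow.next w (s≤s (+-monoʳ-≤ 5 (≤-pred w≤n))) (generic-start w (<⇒≤ w≤n)))

  -- The generic rows end at row `5 + suc n = m`, which is row 0.
  at02 : At 0 2
  at02 = subst (f ⊢ o ⟶_) (S-period₁ 0 2)
    (subst (λ y → At y 2) (trans (+-suc 5 n) refl) (generic-start (suc n) ≤-refl))

  module Row₀ where

    at4 : At 0 4
    at4 = at02 ▷ return₂ 0 2 0<m ≋-refl 3<m refl

    T≡0 : ∀ t → T 0 (t + 5) ≡ 0F
    T≡0 t rewrite +-comm t 5 = refl

    upper : ∀ j → j + 4 < m → At 0 (j + 4)
    upper j j<m = advance* j 0<m T≡0 j<m at4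

    at0 : At 0 0
    at0 = wrap₀ 0<m refl (subst (At 0) (+-comm (1 + n) 4) (upper (1 + n) (≤-reflexive (cong suc (+-comm (1 + n) 4)))))

    at1 : At 0 1
    at1 = advance 0<m 1<m refl at0

    at3 : At 0 3
    at3 = at1 ▷ return₂ 0 1 0<m ≋-refl 2<m refl

    next : At 1 4
    next = at3 ▷ return₁ 0 3 0<m ≋-refl 4<m refl

    -- Order of visit: 2, 4, 5, ..., m - 1, 0, 1, 3, then the exit to row 1.
    row : Row 0
    row 0 _ = at0
    row 1 _ = at1
    row 2 _ = at02
    row 3 _ = at3
    row (suc (suc (suc (suc z)))) z<m = subst (At 0) (+-comm z 4) (upper z (subst (_< m) (+-comm 4 z) z<m))

  module Row₁ where

    T≡0 : ∀ t → T 1 (t + 5) ≡ 0F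
    T≡0 t rewrite +-comm t 5 = refl

    upper : ∀ j → j + 4 < m → At 1 (j + 4)
    upper j j<m = advance* j 1<m T≡0 j<m Row₀.next

    at0 : At 1 0
    at0 = wrap₀ 1<m refl (subst (At 1) (+-comm (1 + n) 4) (upper (1 + n) (≤-reflexive (cong suc (+-comm (1 + n) 4)))))

    at1 : At 1 1
    at1 = advance 1<m 1<m refl at0

    at2 : At 1 2
    at2 = advance 1<m 2<m refl at1

    at3 : At 1 3
    at3 = advance 1<m 3<m refl at2

    next : At 2 4
    next = at3 ▷ return₁ 1 3 1<m ≋-refl 4<m refl

    row : Row 1
    row 0 _ = at0
    row 1 _ = at1
    row 2 _ = at2
    row 3 _ = at3
    row (suc (suc (suc (suc z)))) z<m = subst (At 1) (+-comm z 4) (upper z (subst (_< m) (+-comm 4 z) z<m))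

  module Row₂ where

    jump : ∀ z → 4 + z < m → At 2 (3 + z) → At 2 (5 + z)
    jump z z<m r = r ▷ return₂ 2 (3 + z) 2<m ≋-refl z<m refl

    -- From z = 3 on this row moves in steps of two. As `m` is even, the pass from 4 runs into m,
    -- that is 0; the unit steps from 0 to 3 change the parity, and the odd pass ends at m - 1, the
    -- exit.
    evens : ∀ j → 4 + j * 2 ≤ m → At 2 (4 + j * 2)
    evens zero    _   = Row₁.next
    evens (suc j) j<m = jump (1 + j * 2) j<m (evens j (<⇒≤ (<⇒≤ j<m)))

    at0 : At 2 0
    at0 = wrap-z 2 0 (evens (suc h) ≤-refl)

    at1 : At 2 1
    at1 = advance 2<m 1<m refl at0

    at2 : At 2 2
    at2 = advance 2<m 2<m refl at1

    at3 : At 2 3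
    at3 = advance 2<m 3<m refl at2

    odds : ∀ j → 5 + j * 2 < m → At 2 (5 + j * 2)
    odds zero    _   = at3 ▷ return₂ 2 3 2<m ≋-refl 4<m refl
    odds (suc j) j<m = jump (2 + j * 2) (<⇒≤ j<m) (odds j (<⇒≤ (<⇒≤ j<m)))

    next : At 3 0
    next = wrap-z 3 0 (odds h ≤-refl ▷ return₁ 2 last 2<m m≋0 0<m refl)

    row : Row 2
    row 0 _ = at0
    row 1 _ = at1
    row 2 _ = at2
    row 3 _ = at3
    row (suc (suc (suc (suc z)))) z<m with parity z
    ... | j , inj₁ refl = evens j (<⇒≤ z<m)
    ... | j , inj₂ refl = odds j z<m

  module Row₃ where

    T≡0 : ∀ t → T 3 (t + 1) ≡ 0F
    T≡0 t rewrite +-comm t 1 = refl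

    row : Row 3
    row z z<m = subst (At 3) (+-identityʳ z) (advance* z 3<m T≡0 (subst (_< m) (sym (+-identityʳ z)) z<m) Row₂.next)

    next : At 4 0
    next = wrap-z 4 0 (row last ≤-refl ▷ return₁ 3 last 3<m m≋0 0<m refl)

  module Row₄ where

    at2 : At 4 2
    at2 = Row₃.next ▷ return₂ 4 0 4<m ≋-refl 1<m refl

    T≡0 : ∀ t → T 4 (t + 3) ≡ 0F
    T≡0 t rewrite +-comm t 3 = refl

    upper : ∀ j → j + 2 < m → At 4 (j + 2)
    upper j j<m = advance* j 4<m T≡0 j<m at2

    at1 : At 4 1
    at1 = wrap-z 4 1 (subst (At 4) (+-comm (3 + n) 2) (upper (3 + n) (≤-reflexive (cong suc (+-comm (3 + n) 2))))
      ▷ return₂ 4 last 4<m m≋0 0<m refl)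

    row : Row 4
    row 0 _ = Row₃.next
    row 1 _ = at1
    row (suc (suc z)) z<m = subst (At 4) (+-comm z 2) (upper z (subst (_< m) (+-comm 2 z) z<m))

    -- Row 4 is visited in the order 0, 2, 3, ..., m - 1, 1, and its exit leads to the entry of row
    -- 5, the first generic row.
    closed : f ⊢ o ⟶⁺ o
    closed = ⟶-⟶⁺-trans at1 (return₁ 4 1 4<m ≋-refl 2<m refl)

  rows : ∀ y → y < m → Row y
  rows 0 _ = Row₀.row
  rows 1 _ = Row₁.row
  rows 2 _ = Row₂.row
  rows 3 _ = Row₃.row
  rows 4 _ = Row₄.row
  rows (suc (suc (suc (suc (suc w))))) y<m = GenericRow.row w y<m
    (generic-start w (<⇒≤ (≤-pred (≤-pred (≤-pred (≤-pred (≤-pred y<m)))))))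

  section : AllAt f o 1
  section v@(x , y , z) at1 = subst (f ⊢ o ⟶_) S≡v (rows (toℕ y) (toℕ<n y) (toℕ z) (toℕ<n z))
    where
    x≋ : 7 + (5 + n) * (toℕ y + toℕ z) ≋ toℕ x
    x≋ = ≋-+-cancelˡ (n + (toℕ y + toℕ z)) (≋-trans
      (≡⇒≋ (rearrange n _ (toℕ y) (toℕ z)))
      (≋-trans (S-layer (toℕ y) (toℕ z)) (≋-trans (≋-sym at1) (≡⇒≋ (sym (rearrange n (toℕ x) (toℕ y) (toℕ z)))))))
      where
      rearrange : ∀ n a y z → n + (y + z) + a ≡ n + (a + y + z)
      rearrange = solve-∀
    S≡v : pt (S (toℕ y) (toℕ z)) ≡ v
    S≡v = trans (pt-cong x≋ (≋-refl {toℕ y}) (≋-refl {toℕ z})) (pt-coords v)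

  singleOrbit : SingleOrbit f
  singleOrbit = o , Row₄.closed , cover 1 section onto
    where
    onto : ∀ k → 1 ≤ k → k < 1 + (5 + n) → Onto f k
    onto 1             _ k<m = const-layer-onto 2F ≋-refl k<m λ _ → refl
    onto (suc (suc k)) _ k<m = const-layer-onto 0F ≋-refl k<m λ _ → refl

  even-decomposition : Decomposition m
  even-decomposition = rotation-decomposition d d-latin singleOrbit

theorem1p1 : (m : ℕ) → m ≥ 3 →
    Σ (Fin 3 → HamiltonCycle m) λ C → ArcPartition C
theorem1p1 0 ()
theorem1p1 1 (s≤s ())
theorem1p1 2 (s≤s (s≤s ()))
theorem1p1 3 _ = decomposition₃
theorem1p1 4 _ = decomposition₄
theorem1p1 (suc (suc (suc (suc (suc n))))) _ with parity n
-- As `m` is `5 + n`, an even `n` gives an odd `m`; an odd `n` gives `m = 6 + h * 2`.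
... | h , inj₁ refl = Odd.odd-decomposition (h * 2) h refl
... | h , inj₂ refl = EvenOrbit.even-decomposition h
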